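{- Let $k\ge 2$ be an integer, $\pi\in S_k$, $\epsilon>0$, and let $\delta_0\ge 1$ and $\Delta_0$ be positive constants. There is a constant $c=c(k,\pi,\epsilon,\delta_0,\Delta_0)$ such that the following holds. Let $n, L$ be positive integers and let $\Lambda$ be a $k$-uniform hypergraph on vertex set $\{1,\dots,n\}$ which contains a collection of $L$-vertex cliques (sets of $L$ vertices all of whose $k$-subsets are edges of $\Lambda$) such that each of the $n$ vertices belongs to at least $\delta_0$ and at most $\Delta_0$ cliques of the collection. Then the number of $\sigma\in S_n$ that $\Lambda$-avoid $\pi$ is at most \[\left(\frac{c\, n\log^{2+\epsilon}n}{L}\right)^n.\]
   Context: For a $k$-uniform hypergraph $\Lambda$ on vertex set $\{1,\dots,n\}$, a permutation $\sigma\in S_n$ $\Lambda$-contains $\pi\in S_k$ if there exist integers $1\le x_1<\dots<x_k\le n$ with $\{x_1,\dots,x_k\}\in E(\Lambda)$ such that for all $i,j$, $\pi(i)<\pi(j)\iff\sigma(x_i)<\sigma(x_j)$; otherwise $\sigma$ $\Lambda$-avoids $\pi$.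
   Formalization: The formal theorem takes n ≥ 2 instead of every positive n: for n = 1 the bound is 0 because log 1 = 0, while the single permutation avoids π (L = 1, collection {{1}}), so the claim fails there. -}

module Defs where

open import Algebra.Definitions.RawSemiring using ()
open import Data.Fin as Fin using (Fin; zero; suc)
import Data.Fin.Properties as Fin
open import Data.Fin.Permutation as Perm using (Permutation′; _⟨$⟩ʳ_; insert; remove; insert-remove; insert-punchIn; _≈_)
open import Data.Fin.Subset as Subset using (Subset; ⁅_⁆; ⋃; ∣_∣; _∈_; _⊆_)
open import Data.Fin.Subset.Properties using (_∈?_)
import Data.Integer as ℤ
open import Data.List as List using (List; []; _∷_; length; filter; allFin; cartesianProductWith)
open import Data.List.Relation.Unary.All as All using (All; []; _∷_)
import Data.List.Relation.Unary.All.Properties as All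
open import Data.List.Relation.Unary.Any as Any using (Any; here; there)
import Data.List.Relation.Unary.Any.Properties as Any
open import Data.List.Relation.Unary.AllPairs as AllPairs using (AllPairs; []; _∷_)
import Data.List.Relation.Unary.AllPairs.Properties as AllPairs
open import Data.List.Membership.Propositional.Properties using (∈-allFin)
open import Data.List.Relation.Unary.Unique.Propositional.Properties using (allFin⁺)
open import Data.Nat as ℕ using (ℕ; zero; suc)
open import Data.Product using (_×_; _,_; ∃; ∃-syntax; proj₁; proj₂)
open import Data.Rational as ℚ using (ℚ; 0ℚ; 1ℚ; ↥_; ↧ₙ_)
import Data.Rational.Properties as ℚ
open import Data.Sum as Sum using (_⊎_; inj₁; inj₂)
open import Data.Vec as Vec using (Vec; []; _∷_; lookup; toList)
open import Function using (_∘_; _⇔_; mk⇔; Equivalence)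
open import Level using (0ℓ)
open import Relation.Binary.PropositionalEquality
open import Relation.Nullary using (¬_; Dec; yes; no; contradiction)
open import Relation.Nullary.Decidable using (map′; _×-dec_; _→-dec_; ¬?)
open import Relation.Unary using (Pred; Decidable)
import Relation.Unary as Unary

private
  variable
    k n : ℕ

-- The vertex set {1,…,n} is Fin n.
-- Decidability of edges is what makes "the number of σ such that …" a
-- natural number constructively; classically it is no restriction.
record UniformHypergraph (k n : ℕ) : Set₁ where
  field
    Edge    : Pred (Subset n) 0ℓ
    edge?   : Decidable Edge
    uniform : ∀ {e} → Edge e → ∣ e ∣ ≡ k

open UniformHypergraph public

IsClique : UniformHypergraph k n → ℕ → Subset n → Set
IsClique {k} Λ L S = ∣ S ∣ ≡ L × (∀ e → e ⊆ S → ∣ e ∣ ≡ k → Edge Λ e)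

degree : List (Subset n) → Fin n → ℕ
degree 𝒞 v = length (filter (v ∈?_) 𝒞)

image : Vec (Fin n) k → Subset n
image xs = ⋃ (List.map ⁅_⁆ (toList xs))

OccursAt : UniformHypergraph k n → Permutation′ k → Permutation′ n → Vec (Fin n) k → Set
OccursAt Λ π σ xs =
    (∀ i j → i Fin.< j → lookup xs i Fin.< lookup xs j)
  × Edge Λ (image xs)
  × (∀ i j → (π ⟨$⟩ʳ i Fin.< π ⟨$⟩ʳ j) ⇔ (σ ⟨$⟩ʳ lookup xs i Fin.< σ ⟨$⟩ʳ lookup xs j))

Contains : UniformHypergraph k n → Permutation′ k → Permutation′ n → Set
Contains Λ π σ = ∃[ xs ] OccursAt Λ π σ xs

Avoids : UniformHypergraph k n → Permutation′ k → Permutation′ n → Set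
Avoids Λ π σ = ¬ Contains Λ π σ

_⇔-dec_ : {A B : Set} → Dec A → Dec B → Dec (A ⇔ B)
a? ⇔-dec b? = map′ (λ (f , g) → mk⇔ f g) (λ e → Equivalence.to e , Equivalence.from e)
                   ((a? →-dec b?) ×-dec (b? →-dec a?))

occursAt? : (Λ : UniformHypergraph k n) (π : Permutation′ k) (σ : Permutation′ n) →
            Decidable (OccursAt Λ π σ)
occursAt? Λ π σ xs =
        Fin.all? (λ i → Fin.all? (λ j → (i Fin.<? j) →-dec (lookup xs i Fin.<? lookup xs j)))
  ×-dec edge? Λ (image xs)
  ×-dec Fin.all? (λ i → Fin.all? (λ j → (_ Fin.<? _) ⇔-dec (_ Fin.<? _)))

anyVec? : {P : Pred (Vec (Fin n) k) 0ℓ} → Decidable P → Dec (∃ P)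
anyVec? {k = zero}  P? = map′ ([] ,_) (λ { ([] , p) → p }) (P? [])
anyVec? {k = suc k} P? = map′ (λ (x , xs , p) → x ∷ xs , p) (λ { (x ∷ xs , p) → x , xs , p })
                              (Fin.any? (λ x → anyVec? (λ xs → P? (x ∷ xs))))

avoids? : (Λ : UniformHypergraph k n) (π : Permutation′ k) → Decidable (Avoids Λ π)
avoids? Λ π σ = ¬? (anyVec? (occursAt? Λ π σ))

-- Each element of Sₙ occurs exactly once, up to pointwise equality; see
-- permutations-complete and permutations-unique.
permutations : ∀ n → List (Permutation′ n)
permutations zero    = Perm.id ∷ []
permutations (suc n) = cartesianProductWith (insert zero) (allFin (suc n)) (permutations n)

avoidingCount : UniformHypergraph k n → Permutation′ k → ℕ
avoidingCount {n = n} Λ π = length (filter (avoids? Λ π) (permutations n))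

insert-cong : ∀ i (π ρ : Permutation′ n) → π ≈ ρ → insert zero i π ≈ insert zero i ρ
insert-cong i π ρ π≈ρ zero    = refl
insert-cong i π ρ π≈ρ (suc k) = cong (Fin.punchIn i) (π≈ρ k)

permutations-complete : (σ : Permutation′ n) → Any (σ ≈_) (permutations n)
permutations-complete {zero}  σ = here λ ()
permutations-complete {suc n} σ =
  Any.cartesianProductWith⁺ (insert zero)
    (λ { {i} {ρ} refl σ′≈ρ k → trans (sym (insert-remove zero σ k))
                                     (insert-cong i (remove zero σ) ρ σ′≈ρ k) })
    (∈-allFin (σ ⟨$⟩ʳ zero))
    (permutations-complete (remove zero σ))

permutations-unique : ∀ n → AllPairs (λ σ ρ → ¬ σ ≈ ρ) (permutations n)
permutations-unique zero    = [] ∷ []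
permutations-unique (suc n) = go (allFin⁺ (suc n))
  where
  rows : List (Fin (suc n)) → List (Permutation′ (suc n))
  rows is = cartesianProductWith (insert zero) is (permutations n)

  apart : ∀ {i} is → All (i ≢_) is → ∀ ρ → All (λ σ → ¬ insert zero i ρ ≈ σ) (rows is)
  apart []       []          ρ = []
  apart (j ∷ is) (i≢j ∷ i≢s) ρ =
    All.++⁺ (All.map⁺ (All.universal (λ _ eq → i≢j (eq zero)) (permutations n))) (apart is i≢s ρ)

  go : ∀ {is} → AllPairs _≢_ is → AllPairs (λ σ ρ → ¬ σ ≈ ρ) (rows is)
  go []                     = []
  go {i ∷ is} (i≢s ∷ uniq) = AllPairs.++⁺
    (AllPairs.map⁺ (AllPairs.map
      (λ ¬eq eq → ¬eq (λ k → Fin.punchIn-injective i _ _ (eq (suc k))))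
      (permutations-unique n)))
    (go uniq)
    (All.map⁺ (All.universal (apart is i≢s) (permutations n)))

infixr 8 _^ℚ_
_^ℚ_ : ℚ → ℕ → ℚ
_^ℚ_ = Algebra.Definitions.RawSemiring._^_ ℚ.+-*-rawSemiring

ℕ→ℚ : ℕ → ℚ
ℕ→ℚ m = ℤ.+ m ℚ./ 1

-- Dedekind reals: Lower q means q < x, and Upper q means x < q.
record ℝ : Set₁ where
  field
    Lower Upper     : Pred ℚ 0ℓ
    lower-inhabited : ∃ Lower
    upper-inhabited : ∃ Upper
    lower-rounded   : ∀ q → Lower q ⇔ (∃[ r ] q ℚ.< r × Lower r)
    upper-rounded   : ∀ q → Upper q ⇔ (∃[ r ] r ℚ.< q × Upper r)
    disjoint        : ∀ q → ¬ (Lower q × Upper q)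
    located         : ∀ {q r} → q ℚ.< r → Lower q ⊎ Upper r

open ℝ public

private
  p-1<p : ∀ p → p ℚ.- 1ℚ ℚ.< p
  p-1<p p = subst (p ℚ.- 1ℚ ℚ.<_) (ℚ.+-identityʳ p) (ℚ.+-monoʳ-< p (ℚ.negative⁻¹ (ℚ.- 1ℚ)))

  p<p+1 : ∀ p → p ℚ.< p ℚ.+ 1ℚ
  p<p+1 p = subst (ℚ._< p ℚ.+ 1ℚ) (ℚ.+-identityʳ p) (ℚ.+-monoʳ-< p (ℚ.positive⁻¹ 1ℚ))

  q+p-p : ∀ q p → q ℚ.+ p ℚ.- p ≡ q
  q+p-p q p = trans (ℚ.+-assoc q p (ℚ.- p))
                    (trans (cong (q ℚ.+_) (ℚ.+-inverseʳ p)) (ℚ.+-identityʳ q))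

  q-p+p : ∀ q p → q ℚ.- p ℚ.+ p ≡ q
  q-p+p q p = trans (ℚ.+-assoc q (ℚ.- p) p)
                    (trans (cong (q ℚ.+_) (ℚ.+-inverseˡ p)) (ℚ.+-identityʳ q))

fromℚ : ℚ → ℝ
fromℚ p = record
  { Lower           = ℚ._< p
  ; Upper           = p ℚ.<_
  ; lower-inhabited = p ℚ.- 1ℚ , p-1<p p
  ; upper-inhabited = p ℚ.+ 1ℚ , p<p+1 p
  ; lower-rounded   = λ q → mk⇔ ℚ.<-dense (λ (r , q<r , r<p) → ℚ.<-trans q<r r<p)
  ; upper-rounded   = λ q → mk⇔ (λ p<q → let (r , p<r , r<q) = ℚ.<-dense p<q in r , r<q , p<r)
                                (λ (r , r<q , p<r) → ℚ.<-trans p<r r<q)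
  ; disjoint        = λ q (q<p , p<q) → ℚ.<-asym q<p p<q
  ; located         = located′
  }
  where
  located′ : ∀ {q r} → q ℚ.< r → q ℚ.< p ⊎ p ℚ.< r
  located′ {q} q<r with q ℚ.<? p
  ... | yes q<p = inj₁ q<p
  ... | no  q≮p = inj₂ (ℚ.≤-<-trans (ℚ.≮⇒≥ q≮p) q<r)

fromℕ : ℕ → ℝ
fromℕ m = fromℚ (ℕ→ℚ m)

infixl 6 _+ℝ_
_+ℝ_ : ℚ → ℝ → ℝ
p +ℝ x = record
  { Lower           = λ q → Lower x (q ℚ.- p)
  ; Upper           = λ q → Upper x (q ℚ.- p)
  ; lower-inhabited = let (q , l) = lower-inhabited x in q ℚ.+ p , subst (Lower x) (sym (q+p-p q p)) l
  ; upper-inhabited = let (q , u) = upper-inhabited x in q ℚ.+ p , subst (Upper x) (sym (q+p-p q p)) u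
  ; lower-rounded   = λ q → mk⇔
      (λ l → let (r , q-p<r , l′) = Equivalence.to (lower-rounded x _) l in
             r ℚ.+ p , subst (ℚ._< r ℚ.+ p) (q-p+p q p) (ℚ.+-monoˡ-< p q-p<r)
                     , subst (Lower x) (sym (q+p-p r p)) l′)
      (λ (r , q<r , l) → Equivalence.from (lower-rounded x _)
             (r ℚ.- p , ℚ.+-monoˡ-< (ℚ.- p) q<r , l))
  ; upper-rounded   = λ q → mk⇔
      (λ u → let (r , r<q-p , u′) = Equivalence.to (upper-rounded x _) u in
             r ℚ.+ p , subst (r ℚ.+ p ℚ.<_) (q-p+p q p) (ℚ.+-monoˡ-< p r<q-p)
                     , subst (Upper x) (sym (q+p-p r p)) u′)
      (λ (r , r<q , u) → Equivalence.from (upper-rounded x _)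
             (r ℚ.- p , ℚ.+-monoˡ-< (ℚ.- p) r<q , u))
  ; disjoint        = λ q → disjoint x (q ℚ.- p)
  ; located         = λ q<r → located x (ℚ.+-monoˡ-< (ℚ.- p) q<r)
  }

infix 4 _<ℝ_ _≤ᵘ_ _≤ℝ_

_<ℝ_ : ℝ → ℝ → Set
x <ℝ y = ∃[ q ] Upper x q × Lower y q

-- A real number x is determined by its upper cut {q ∈ ℚ : x < q}, and
-- x ≤ y iff every rational above y is above x.
UpperCut : Set₁
UpperCut = Pred ℚ 0ℓ

_≤ᵘ_ : UpperCut → UpperCut → Set
x ≤ᵘ y = y Unary.⊆ x

_≤ℝ_ : ℝ → ℝ → Set
x ≤ℝ y = Upper x ≤ᵘ Upper y

-- Products and natural powers are those of nonnegative reals, which is the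
-- only way they are used: if x, y ≥ 0 then x y < q iff a b < q for some
-- rationals a > x and b > y.

infixl 7 _*ᵘ_ _/ᵘ_
infixr 8 _^ᵘ_ _^ʳ_

_*ᵘ_ : UpperCut → UpperCut → UpperCut
(x *ᵘ y) q = ∃[ a ] ∃[ b ] x a × y b × a ℚ.* b ℚ.< q

_/ᵘ_ : UpperCut → (L : ℕ) → .{{ℕ.NonZero L}} → UpperCut
(x /ᵘ L) q = x (q ℚ.* ℕ→ℚ L)

_^ᵘ_ : UpperCut → ℕ → UpperCut
(x ^ᵘ m) q = ∃[ a ] x a × a ^ℚ m ℚ.< q

-- The natural logarithm of m ≥ 1: for q > 0, ln m < q iff m < e^q, and e^q
-- is the limit of the strictly increasing sequence (1 + q/j)^j, j ≥ 1.
lnᵘ : ℕ → UpperCut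
lnᵘ m q = 0ℚ ℚ.< q × ∃[ j ] ℕ→ℚ m ℚ.< (1ℚ ℚ.+ q ℚ.* (ℤ.+ 1 ℚ./ suc j)) ^ℚ suc j

-- a^r < q for rationals a > 0 and r = s/t ≥ 0: it means q > 0 and a^s < q^t.
Power< : ℚ → ℚ → ℚ → Set
Power< a r q = 0ℚ ℚ.< q × a ^ℚ ℤ.∣ ↥ r ∣ ℚ.< q ^ℚ ↧ₙ r

-- Real powers x^y for real x, y > 0.  For fixed a > 0 the function
-- t ↦ a^t is monotone (increasing or decreasing according to whether a > 1),
-- so a^y is at most the larger of a^r and a^s whenever r < y < s.  By
-- continuity, x^y < q iff a^r < q and a^s < q for some rationals a > x and
-- 0 ≤ r < y < s.
_^ʳ_ : UpperCut → ℝ → UpperCut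
(x ^ʳ y) q = ∃[ a ] ∃[ r ] ∃[ s ]
  x a × 0ℚ ℚ.≤ r × Lower y r × Upper y s × Power< a r q × Power< a s q

{-# OPTIONS --safe #-}
-- Choosing one clique for every vertex splits the positions into N colour
-- classes, where N L ≤ Δ₀ n by double counting.  Given the colours of all
-- values (N ^ n possibilities), σ is determined by the permutation obtained
-- from it by sorting positions and values by colour, which is block diagonal.
-- If σ avoids π, then this permutation avoids the pattern π with a maximum
-- prepended, because that pattern is indecomposable.  By the Stanley–Wilf
-- conjecture at most A ^ n permutations do so.  This bounds the number of σ by
-- (A Δ₀ n / L) ^ n, which suffices because ln n ≥ ½ for n ≥ 2.
--
-- The Stanley–Wilf conjecture is proved following Klazar, Marcus and Tardos:
-- for a pattern of length k + 1, contract b × b blocks, where b > k².  Few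
-- blocks have more than k nonempty rows or columns, and the others have at
-- most k² entries, so by induction an avoiding matrix has linearly many
-- entries.  Hence a matrix is recovered from its contraction by a linear
-- number of bits, which add up to a linear number over all contractions.
module Submission where

open import Algebra.Bundles using (CommutativeRing)
open import Algebra.Properties.CommutativeSemiring.Exp using ()
open import Algebra.Properties.Semiring.Sum using ()
open import Data.Bool using (Bool; true; false; T; not; _∧_; if_then_else_)
open import Data.Fin as Fin using (Fin; zero; suc; toℕ; combine; inject≤; fromℕ<; _↑ˡ_; _↑ʳ_; funToFin)
open import Data.Fin.Permutation as Perm using (Permutation′; _⟨$⟩ʳ_; _⟨$⟩ˡ_; insert)
import Data.Fin.Properties as Fin
open import Data.Fin.Subset using (Subset; inside; outside; ⁅_⁆; _∪_; ∣_∣; _∈_; _∉_; _⊆_)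
open import Data.Fin.Subset.Properties using (_∈?_; ∪-identityˡ; x∈p∪q⁻; x∈⁅y⁆⇒x≡y; ∉⊥; ∣⊥∣≡0)
import Data.Integer as ℤ
import Data.Integer.Properties as ℤ
open import Data.List as List using (List; []; _∷_; _++_; length; concat; tabulate)
open import Data.List.Membership.Propositional.Properties using (∈-lookup)
import Data.List.Properties as List
open import Data.List.Relation.Unary.All as All using (All; []; _∷_)
import Data.List.Relation.Unary.All.Properties as All
open import Data.List.Relation.Unary.AllPairs using (AllPairs; []; _∷_)
import Data.List.Relation.Unary.AllPairs.Properties as AllPairs
open import Data.List.Relation.Unary.Any as Any using (Any)
open import Data.List.Relation.Unary.Any.Properties using (lookup-index)
open import Data.List.Relation.Unary.Unique.Propositional using (Unique)
open import Data.Nat as ℕ using (ℕ; zero; suc; _+_; _*_; _^_; _≤_; _<_; _≤ᵇ_; _<ᵇ_; z≤n; s≤s; NonZero)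
import Data.Nat.Properties as ℕ
open import Data.Nat.Tactic.RingSolver using (solve-∀)
open import Data.Product using (_×_; _,_; ∃₂; ∃-syntax; proj₁; proj₂)
open import Data.Rational as ℚ using (ℚ; 0ℚ; 1ℚ; ½; toℚᵘ; ↥_; ↧_; ↧ₙ_; *<*; *≤*)
open import Data.Rational.Literals using (fromℤ)
import Data.Rational.Properties as ℚ
open import Data.Rational.Solver using (module +-*-Solver)
import Data.Rational.Unnormalised as ℚᵘ
import Data.Rational.Unnormalised.Properties as ℚᵘ
open import Data.Sum using (inj₁; inj₂)
open import Data.Vec as Vec using (Vec; []; _∷_; lookup; here; there)
open import Data.Vec.Properties using (lookup∘tabulate)
open import Defs
open import Function using (_∘_; flip; _⇔_; mk⇔; Equivalence)
open import Relation.Binary using (tri<; tri≈; tri>)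
open import Relation.Binary.PropositionalEquality
open import Relation.Nullary using (¬_; yes; no; does; contradiction)
open import Relation.Nullary.Decidable using (⌊_⌋; toWitness; fromWitness; T?; _×-dec_)

open Algebra.Properties.Semiring.Sum ℕ.+-*-semiring
  using (sum; ∑-comm; ∑-distrib-+; *-distribˡ-sum; *-distribʳ-sum; sum-cong-≗)
open Algebra.Properties.CommutativeSemiring.Exp (CommutativeRing.commutativeSemiring ℚ.+-*-commutativeRing)
  using (^-homo-*; ^-assocʳ; ^-distrib-*)

private
  variable
    k m n N : ℕ

-- Finite sums

sum-mono-≤ : {f g : Fin n → ℕ} → (∀ i → f i ≤ g i) → sum f ≤ sum g
sum-mono-≤ {zero}  f≤g = z≤n
sum-mono-≤ {suc n} f≤g = ℕ.+-mono-≤ (f≤g zero) (sum-mono-≤ (f≤g ∘ suc))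

sum-mono-< : {f g : Fin n → ℕ} → (∀ i → f i ≤ g i) → ∀ i → f i < g i → sum f < sum g
sum-mono-< f≤g zero    f<g = ℕ.+-mono-<-≤ f<g (sum-mono-≤ (f≤g ∘ suc))
sum-mono-< f≤g (suc i) f<g = ℕ.+-mono-≤-< (f≤g zero) (sum-mono-< (f≤g ∘ suc) i f<g)

sum-const : ∀ n c → sum {n} (λ _ → c) ≡ n * c
sum-const zero    c = refl
sum-const (suc n) c = cong (c +_) (sum-const n c)

sum-bounded : ∀ {c} {f : Fin n → ℕ} → (∀ i → f i ≤ c) → sum f ≤ n * c
sum-bounded {n} {c} f≤c = subst (_ ≤_) (sum-const n c) (sum-mono-≤ f≤c)

sum-+ : ∀ m (f : Fin (m + n) → ℕ) → sum f ≡ sum (f ∘ (_↑ˡ n)) + sum (f ∘ (m ↑ʳ_))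
sum-+ zero    f = refl
sum-+ (suc m) f = trans (cong (f zero +_) (sum-+ m (f ∘ suc))) (sym (ℕ.+-assoc (f zero) _ _))

sum-combine : ∀ m (f : Fin (m * n) → ℕ) → sum f ≡ sum {m} (λ i → sum (λ j → f (combine i j)))
sum-combine         zero    f = refl
sum-combine {n = n} (suc m) f = trans (sum-+ n f) (cong (sum (f ∘ (_↑ˡ (m * n))) +_) (sum-combine m (f ∘ (n ↑ʳ_))))

-- Indicator values and counting indices that satisfy a predicate.

χ : Bool → ℕ
χ false = 0
χ true  = 1

χ≤1 : ∀ x → χ x ≤ 1
χ≤1 false = z≤n
χ≤1 true  = ℕ.≤-refl

χ-mono : ∀ {x y} → (T x → T y) → χ x ≤ χ y
χ-mono {false}         f = z≤n
χ-mono {true} {true}   f = ℕ.≤-refl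
χ-mono {true} {false}  f = contradiction (f _) λ ()

count : (Fin n → Bool) → ℕ
count p = sum (χ ∘ p)

count≤n : (p : Fin n → Bool) → count p ≤ n
count≤n {n} p = subst (count p ≤_) (ℕ.*-identityʳ n) (sum-bounded (χ≤1 ∘ p))

Increasing : (Fin k → Fin n) → Set
Increasing f = ∀ i j → i Fin.< j → f i Fin.< f j

enumerate : (p : Fin n → Bool) → k ≤ count p → ∃[ f ] (Increasing {k} f × ∀ i → T (p (f i)))
enumerate {k = zero} p _ = (λ ()) , (λ ()) , λ ()
enumerate {suc n} {suc k} p k<c with p zero in eq
... | false = let f , inc , ok = enumerate (p ∘ suc) k<c in
  suc ∘ f , (λ i j i<j → s≤s (inc i j i<j)) , ok
... | true = f′ , inc′ , ok′
  where
  IH = enumerate (p ∘ suc) (ℕ.s≤s⁻¹ k<c)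
  f = proj₁ IH

  f′ : Fin (suc k) → Fin (suc n)
  f′ zero    = zero
  f′ (suc i) = suc (f i)

  inc′ : Increasing f′
  inc′ zero    (suc j) _   = s≤s z≤n
  inc′ (suc i) (suc j) i<j = s≤s (proj₁ (proj₂ IH) i j (ℕ.s≤s⁻¹ i<j))

  ok′ : ∀ i → T (p (f′ i))
  ok′ zero    = subst T (sym eq) _
  ok′ (suc i) = proj₂ (proj₂ IH) i

count-split : (p q : Fin n → Bool) → count p ≡ count (λ i → p i ∧ q i) + count (λ i → p i ∧ not (q i))
count-split p q = trans (sum-cong-≗ (λ i → χ-split (p i) (q i)))
                          (∑-distrib-+ (λ i → χ (p i ∧ q i)) (λ i → χ (p i ∧ not (q i))))
  where
  χ-split : ∀ x y → χ x ≡ χ (x ∧ y) + χ (x ∧ not y)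
  χ-split false y     = refl
  χ-split true  false = refl
  χ-split true  true  = refl

T-∧ : ∀ {x y} → T (x ∧ y) → T x × T y
T-∧ {true} {true} _ = _ , _

T⇒≡true : ∀ {x} → T x → x ≡ true
T⇒≡true {true} _ = refl

T-not⇒≡false : ∀ {x} → T (not x) → x ≡ false
T-not⇒≡false {false} _ = refl

-- Splitting b times according to the next value of the profile, and keeping
-- the larger half, loses a factor of at most 2 ^ b.
constant-profile : ∀ {b} (prof : Fin b → Fin n → Bool) (p : Fin n → Bool) → 2 ^ b * k < count p →
  ∃[ q ] ((∀ i → T (q i) → T (p i)) × k < count q ×
          (∀ c i j → T (q i) → T (q j) → prof c i ≡ prof c j))
constant-profile {k = k} {zero} prof p k<c =
  p , (λ _ t → t) , subst (_< count p) (ℕ.+-identityʳ k) k<c , λ ()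
constant-profile {n} {k} {suc b} prof p large with 2 ^ b * k ℕ.<? count (λ i → p i ∧ prof zero i)
... | yes large₁ = let q , q⊆ , k<q , const = constant-profile (prof ∘ suc) _ large₁ in
  q , (λ i → proj₁ ∘ T-∧ ∘ q⊆ i) , k<q ,
  λ { zero    i j qi qj → trans (T⇒≡true (proj₂ (T-∧ (q⊆ i qi)))) (sym (T⇒≡true (proj₂ (T-∧ (q⊆ j qj)))))
    ; (suc c) → const c }
... | no ¬large₁ = let q , q⊆ , k<q , const = constant-profile (prof ∘ suc) _ large₂ in
  q , (λ i → proj₁ ∘ T-∧ ∘ q⊆ i) , k<q ,
  λ { zero    i j qi qj → trans (T-not⇒≡false (proj₂ (T-∧ {p i} (q⊆ i qi))))
                                (sym (T-not⇒≡false (proj₂ (T-∧ {p j} (q⊆ j qj)))))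
    ; (suc c) → const c }
  where
  open ℕ.≤-Reasoning
  c₁ = count (λ i → p i ∧ prof zero i)
  c₂ = count (λ i → p i ∧ not (prof zero i))

  large₂ : 2 ^ b * k < c₂
  large₂ = ℕ.+-cancelˡ-< (2 ^ b * k) _ _ (begin-strict
    2 ^ b * k + 2 ^ b * k  ≡⟨ double (2 ^ b) k ⟩
    2 ^ suc b * k          <⟨ large ⟩
    count p                ≡⟨ count-split p (prof zero) ⟩
    c₁ + c₂                ≤⟨ ℕ.+-monoˡ-≤ c₂ (ℕ.≮⇒≥ ¬large₁) ⟩
    2 ^ b * k + c₂         ∎)
    where
    double : ∀ x y → x * y + x * y ≡ (x + (x + 0)) * y
    double = solve-∀

-- Pattern containment in 0-1 matrices

Matrix : ℕ → ℕ → Set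
Matrix m n = Fin m → Fin n → Bool

Occurs : Matrix m n → Permutation′ k → Set
Occurs {m} {n} {k} M π = ∃₂ λ (xs : Fin k → Fin m) (ys : Fin k → Fin n) →
  Increasing xs × Increasing ys × ∀ i → T (M (xs i) (ys (π ⟨$⟩ʳ i)))

-- Swapping the roles of rows and columns inverts the pattern. This lets a bound for block columns
-- be reused for block rows.
occurs-transpose : (M : Matrix m n) (π : Permutation′ k) → Occurs (flip M) (Perm.flip π) → Occurs M π
occurs-transpose M π (ys , xs , ys↑ , xs↑ , hits) = xs , ys , xs↑ , ys↑ , λ i →
  subst (λ j → T (M (xs j) (ys (π ⟨$⟩ʳ i)))) (Perm.inverseˡ π) (hits (π ⟨$⟩ʳ i))

weight : Matrix m n → ℕ
weight M = sum λ x → count (M x)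

block : ∀ b → Matrix (m * b) (n * b) → Fin m → Fin n → Matrix b b
block b M I J i j = M (combine I i) (combine J j)

nonemptyRow : Matrix m n → Fin m → Bool
nonemptyRow B i = ⌊ Fin.any? (λ j → T? (B i j)) ⌋

nonemptyColumn : Matrix m n → Fin n → Bool
nonemptyColumn B = nonemptyRow (flip B)

nonempty : Matrix m n → Bool
nonempty B = ⌊ Fin.any? (λ i → T? (nonemptyRow B i)) ⌋

contract : ∀ b → Matrix (m * b) (n * b) → Matrix m n
contract b M I J = nonempty (block b M I J)

wide : ℕ → Matrix m n → Bool
wide k B = k ≤ᵇ count (nonemptyColumn B)

-- Every nonempty block contains an entry, and an occurrence of a permutation uses each chosen block
-- row and block column exactly once. So one entry from each block suffices, and the order of the
-- blocks settles the order of its rows and columns.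
occurs-contract : ∀ b (M : Matrix (m * b) (n * b)) (π : Permutation′ k) →
                  Occurs (contract {m} {n} b M) π → Occurs M π
occurs-contract {m} {n} {k} b M π (xs , ys , xs↑ , ys↑ , hits) =
  (λ i → combine (xs i) (proj₁ (row i))) , (λ j → combine (ys j) (c j)) ,
  (λ i j i<j → Fin.combine-monoˡ-< (proj₁ (row i)) (proj₁ (row j)) (xs↑ i j i<j)) ,
  (λ i j i<j → Fin.combine-monoˡ-< (c i) (c j) (ys↑ i j i<j)) ,
  -- Columns of the pattern are indexed by values, so `c` is read through the inverse of `π` and has
  -- to be transported back to `i`.
  λ i → subst (λ i′ → T (block b M (xs i) (ys (π ⟨$⟩ʳ i)) (proj₁ (row i)) (proj₁ (col i′))))
              {x = i} {y = π ⟨$⟩ˡ (π ⟨$⟩ʳ i)} (sym (Perm.inverseˡ π)) (proj₂ (col i))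
  where
  B : Fin k → Matrix b b
  B i = block b M (xs i) (ys (π ⟨$⟩ʳ i))

  row : ∀ i → ∃[ r ] T (nonemptyRow (B i) r)
  row i = toWitness (hits i)

  col : ∀ i → ∃[ c ] T (B i (proj₁ (row i)) c)
  col i = toWitness (proj₂ (row i))

  c : Fin k → Fin b
  c j = proj₁ (col (π ⟨$⟩ˡ j))

combine-monoʳ-< : ∀ (i : Fin m) {j l : Fin n} → j Fin.< l → combine i j Fin.< combine i l
combine-monoʳ-< i {j} {l} j<l =
  subst₂ _<_ (sym (Fin.toℕ-combine i j)) (sym (Fin.toℕ-combine i l)) (ℕ.+-monoʳ-< _ j<l)

-- More wide blocks than this in one block column include suc k wide blocks
-- with the same nonempty columns, and these contain every pattern of length
-- suc k.
count-wide : ∀ b (M : Matrix (m * b) (n * b)) (π : Permutation′ (suc k)) → ¬ Occurs M π →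
             ∀ (J : Fin n) → count {m} (λ I → wide (suc k) (block b M I J)) ≤ 2 ^ b * k
count-wide {m} {n} {k} b M π avoids J = ℕ.≮⇒≥ λ large →
  let q , q⊆wide , k<q , const = constant-profile profile (λ I → wide (suc k) (block b M I J)) large
      Is , Is↑ , qIs           = enumerate q k<q
      cs , cs↑ , nonempty      = enumerate (λ c → profile c (Is zero)) (ℕ.≤ᵇ⇒≤ _ _ (q⊆wide (Is zero) (qIs zero)))
      -- The row inside each block may be arbitrary, since the block rows `Is` already increase;
      -- only the columns `cs` have to be shared.
      row : ∀ i → ∃[ r ] T (block b M (Is i) J r (cs (π ⟨$⟩ʳ i)))
      row i = toWitness (subst T (const (cs (π ⟨$⟩ʳ i)) (Is zero) (Is i) (qIs zero) (qIs i))
                                 (nonempty (π ⟨$⟩ʳ i)))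
  in avoids ( (λ i → combine (Is i) (proj₁ (row i))) , (λ j → combine J (cs j))
            , (λ i j i<j → Fin.combine-monoˡ-< (proj₁ (row i)) (proj₁ (row j)) (Is↑ i j i<j))
            , (λ i j i<j → combine-monoʳ-< J (cs↑ i j i<j))
            , (λ i → proj₂ (row i)) )
  where
  profile : Fin b → Fin m → Bool
  profile c I = nonemptyColumn (block b M I J) c

-- Linear weight of matrices avoiding a pattern.

sum-linear : ∀ a c (f g h : Fin n → ℕ) →
             sum (λ i → a * f i + c * (g i + h i)) ≡ a * sum f + c * (sum g + sum h)
sum-linear a c f g h = trans (∑-distrib-+ (λ i → a * f i) (λ i → c * (g i + h i)))
  (cong₂ _+_ (sym (*-distribˡ-sum a f))
    (trans (sym (*-distribˡ-sum c (λ i → g i + h i))) (cong (c *_) (∑-distrib-+ g h))))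

-- Every entry lies in the product of the nonempty rows with the nonempty columns.
weight≤rows*columns : (B : Matrix m n) → weight B ≤ count (nonemptyRow B) * count (nonemptyColumn B)
weight≤rows*columns {m} {n} B = begin
  weight B                                     ≤⟨ sum-mono-≤ {m} (λ i → sum-mono-≤ {n} (λ j → entry i j)) ⟩
  sum (λ i → sum (λ j → χ (R i) * χ (C j)))  ≡⟨ sum-cong-≗ (λ i → *-distribˡ-sum (χ (R i)) (χ ∘ C)) ⟨
  sum (λ i → χ (R i) * count C)              ≡⟨ *-distribʳ-sum (count C) (χ ∘ R) ⟨
  count R * count C                           ∎
  where
  open ℕ.≤-Reasoning
  R = nonemptyRow B
  C = nonemptyColumn B

  χ-* : ∀ {x y z} → (T x → T y) → (T x → T z) → χ x ≤ χ y * χ z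
  χ-* {false} f g = z≤n
  χ-* {true}  f g = ℕ.*-mono-≤ (χ-mono {true} f) (χ-mono {true} g)

  entry : ∀ i j → χ (B i j) ≤ χ (R i) * χ (C j)
  entry i j = χ-* {B i j} {R i} {C j} (λ t → fromWitness (j , t)) (λ t → fromWitness (i , t))

-- A block with more than `k` nonempty columns or rows is charged its full area `b * b`. Any other
-- block has all its entries in at most `k` rows and `k` columns, and an empty one costs nothing.
block-weight : ∀ {b} k (B : Matrix b b) →
  weight B ≤ k * k * χ (nonempty B) + b * b * (χ (wide (suc k) B) + χ (wide (suc k) (flip B)))
block-weight {b} k B with wide (suc k) B in w | wide (suc k) (flip B) in t
... | true | x = ℕ.≤-trans (weight≤rows*columns B) (ℕ.≤-trans
        (ℕ.*-mono-≤ (count≤n (nonemptyRow B)) (count≤n (nonemptyColumn B)))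
        (ℕ.≤-trans (ℕ.m≤m*n (b * b) (1 + χ x)) (ℕ.m≤n+m _ _)))
... | false | true = ℕ.≤-trans (weight≤rows*columns B) (ℕ.≤-trans
        (ℕ.*-mono-≤ (count≤n (nonemptyRow B)) (count≤n (nonemptyColumn B)))
        (ℕ.≤-trans (ℕ.m≤m*n (b * b) 1) (ℕ.m≤n+m _ _)))
... | false | false = ℕ.≤-trans (weight≤rows*columns B) (ℕ.≤-trans R*C≤ (ℕ.m≤m+n _ _))
  where
  R = nonemptyRow B
  C = nonemptyColumn B

  narrow : ∀ c → (suc k ≤ᵇ c) ≡ false → c ≤ k
  narrow c eq = ℕ.s≤s⁻¹ (ℕ.≰⇒> λ k<c → subst T eq (ℕ.≤⇒≤ᵇ k<c))

  -- This serves the empty block, where it forces `count R` to vanish.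
  R≤ : count R ≤ b * χ (nonempty B)
  R≤ = sum-bounded (λ i → χ-mono {R i} (λ r → fromWitness (i , r)))

  R*C≤ : count R * count C ≤ k * k * χ (nonempty B)
  R*C≤ with nonempty B | R≤
  ... | true  | _  = ℕ.≤-trans (ℕ.*-mono-≤ (narrow (count R) t) (narrow (count C) w)) (ℕ.m≤m*n (k * k) 1)
  ... | false | R≤0 = ℕ.≤-trans (ℕ.*-monoˡ-≤ (count C) (subst (count R ≤_) (ℕ.*-zeroʳ b) R≤0)) z≤n

weight-blocks : ∀ b (M : Matrix (m * b) (n * b)) →
                weight M ≡ sum {m} (λ I → sum {n} (λ J → weight (block b M I J)))
weight-blocks {m} {n} b M = begin
  weight M
    ≡⟨ sum-combine m _ ⟩
  sum {m} (λ I → sum {b} (λ i → count (M (combine I i))))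
    ≡⟨ sum-cong-≗ {m} (λ I → sum-cong-≗ {b} (λ i → sum-combine n _)) ⟩
  sum {m} (λ I → sum {b} (λ i → sum {n} (λ J → count (block b M I J i))))
    ≡⟨ sum-cong-≗ {m} (λ I → ∑-comm {b} {n} (λ i J → count (block b M I J i))) ⟩
  sum {m} (λ I → sum {n} (λ J → weight (block b M I J))) ∎
  where open ≡-Reasoning

-- `block-weight` is summed over all blocks. The nonempty ones add up to the weight of the
-- contraction, and `count-wide` bounds the wide ones in each block column and the tall ones in each
-- block row.
weight-contract : ∀ b (M : Matrix (m * b) (m * b)) (π : Permutation′ (suc k)) → ¬ Occurs M π →
  weight M ≤ k * k * weight (contract {m} {m} b M) + m * (b * b * (2 ^ b * k + 2 ^ b * k))
weight-contract {m} {k} b M π avoids = begin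
  weight M
    ≡⟨ weight-blocks {m} {m} b M ⟩
  sum {m} (λ I → sum {m} (λ J → weight (block b M I J)))
    ≤⟨ sum-mono-≤ {m} (λ I → sum-mono-≤ {m} (λ J → block-weight k (block b M I J))) ⟩
  sum (λ I → sum (λ J → k * k * χ (M′ I J) + b * b * (χ (W I J) + χ (H I J))))
    ≡⟨ sum-cong-≗ (λ I → sum-linear (k * k) (b * b) (χ ∘ M′ I) (χ ∘ W I) (χ ∘ H I)) ⟩
  sum (λ I → k * k * count (M′ I) + b * b * (count (W I) + count (H I)))
    ≡⟨ sum-linear (k * k) (b * b) (λ I → count (M′ I)) (λ I → count (W I)) (λ I → count (H I)) ⟩
  k * k * weight M′ + b * b * (weight W + weight H)
    ≤⟨ ℕ.+-monoʳ-≤ (k * k * weight M′) (ℕ.*-monoʳ-≤ (b * b) (ℕ.+-mono-≤ weight-W weight-H)) ⟩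
  k * k * weight M′ + b * b * (m * (2 ^ b * k) + m * (2 ^ b * k))
    ≡⟨ cong (k * k * weight M′ +_) (rearrange (b * b) m (2 ^ b * k)) ⟩
  k * k * weight M′ + m * (b * b * (2 ^ b * k + 2 ^ b * k)) ∎
  where
  open ℕ.≤-Reasoning
  M′ W H : Matrix m m
  M′ = contract b M
  W I J = wide (suc k) (block b M I J)
  H I J = wide (suc k) (flip (block b M I J))

  -- The bound holds for each block column, so the order of summation is exchanged first.
  weight-W : weight W ≤ m * (2 ^ b * k)
  weight-W = subst (_≤ m * (2 ^ b * k)) (sym (∑-comm (λ I J → χ (W I J))))
                   (sum-bounded {m} (count-wide {m} {m} b M π avoids))

  -- Tall blocks are the wide blocks of the transpose, which avoids the inverse pattern.
  weight-H : weight H ≤ m * (2 ^ b * k)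
  weight-H = sum-bounded {m} (count-wide {m} {m} b (flip M) (Perm.flip π) (avoids ∘ occurs-transpose M π))

  rearrange : ∀ x m y → x * (m * y + m * y) ≡ m * (x * (y + y))
  rearrange = solve-∀

-- This is `b ^ t`, with the new factor on the right so that a matrix of level `suc t` is by
-- definition a grid of `b` by `b` blocks.
size : ℕ → ℕ → ℕ
size b zero    = 1
size b (suc t) = size b t * b

-- The summand `k * k` pays for the factor that `weight-contract` loses at each level. The 2 leaves
-- room for its additive term, and for the two halves of a code in `square-bound`.
blockSize : ℕ → ℕ
blockSize k = 2 + k * k

-- The additive term of `weight-contract` per block row; the successor covers the matrix with a
-- single cell.
density : ℕ → ℕ
density k = suc (blockSize k * blockSize k * (2 ^ blockSize k * k + 2 ^ blockSize k * k))

SquareMatrix : ℕ → ℕ → Set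
SquareMatrix b t = Matrix (size b t) (size b t)

-- The Füredi-Hajnal bound for sizes that are powers of the block size. The contraction avoids `π`
-- again, so induction gives a recurrence with factor `k * k`, which is smaller than the growth `b`
-- of the side.
weight-linear : (π : Permutation′ (suc k)) → ∀ t (M : SquareMatrix (blockSize k) t) → ¬ Occurs M π →
                weight M ≤ density k * size (blockSize k) t
weight-linear π zero    M avoids = ℕ.≤-trans (sum-bounded {c = 1} (λ i → count≤n (M i))) (s≤s z≤n)
weight-linear {k} π (suc t) M avoids = begin
  weight M
    ≤⟨ weight-contract {s} b M π avoids ⟩
  k * k * weight (contract {s} {s} b M) + s * (b * b * (2 ^ b * k + 2 ^ b * k))
    ≤⟨ ℕ.+-mono-≤ (ℕ.*-monoʳ-≤ (k * k) (weight-linear π t (contract b M) (avoids ∘ occurs-contract b M π)))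
                  (ℕ.*-monoʳ-≤ s (ℕ.n≤1+n _)) ⟩
  k * k * (C * s) + s * C
    ≤⟨ ℕ.m≤m+n _ (C * s) ⟩
  k * k * (C * s) + s * C + C * s
    ≡⟨ square k C s ⟩
  C * (s * b) ∎
  where
  open ℕ.≤-Reasoning
  b = blockSize k
  C = density k
  s = size b t

  square : ∀ k C s → k * k * (C * s) + s * C + C * s ≡ C * (s * (2 + k * k))
  square = solve-∀

-- Encoding avoiding matrices

++-injective : ∀ {A : Set} {ws xs ys zs : List A} → length ws ≡ length ys →
               ws ++ xs ≡ ys ++ zs → ws ≡ ys × xs ≡ zs
++-injective {ws = []}     {ys = []}     _ eq = refl , eq
++-injective {ws = w ∷ ws} {ys = y ∷ ys} l eq =
  let heads , tails = List.∷-injective eq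
      ws≡ys , xs≡zs = ++-injective (ℕ.suc-injective l) tails
  in cong₂ _∷_ heads ws≡ys , xs≡zs

cells : ∀ {A : Set} → (Fin n → List A) → List A
cells f = concat (tabulate f)

length-cells : ∀ {A : Set} (f : Fin n → List A) → length (cells f) ≡ sum (length ∘ f)
length-cells {zero}  f = refl
length-cells {suc n} f = trans (List.length-++ (f zero)) (cong (length (f zero) +_) (length-cells (f ∘ suc)))

length-cells-cong : ∀ {A : Set} {f g : Fin n → List A} → (∀ i → length (f i) ≡ length (g i)) →
                    length (cells f) ≡ length (cells g)
length-cells-cong {f = f} {g} eq =
  trans (length-cells f) (trans (sum-cong-≗ eq) (sym (length-cells g)))

-- A concatenation can be cut back into its pieces once their lengths are known.
cells-injective : ∀ {A : Set} {f g : Fin n → List A} → (∀ i → length (f i) ≡ length (g i)) →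
                  cells f ≡ cells g → ∀ i → f i ≡ g i
cells-injective l eq zero    = proj₁ (++-injective (l zero) eq)
cells-injective l eq (suc i) = cells-injective (l ∘ suc) (proj₂ (++-injective (l zero) eq)) i

entries : Matrix m n → List Bool
entries B = cells (λ i → cells (λ j → List.[ B i j ]))

length-entries : (B : Matrix m n) → length (entries B) ≡ m * n
length-entries {m} {n} B = trans (length-cells (λ i → cells (λ j → List.[ B i j ])))
  (trans (sum-cong-≗ (λ i → trans (length-cells (λ j → List.[ B i j ]))
                                  (trans (sum-const n 1) (ℕ.*-identityʳ n))))
         (sum-const m n))

entries-injective : (B B′ : Matrix m n) → entries B ≡ entries B′ → ∀ i j → B i j ≡ B′ i j
entries-injective {m} {n} B B′ eq i j = List.∷-injectiveˡ
  (cells-injective {f = row B i} {row B′ i} (λ _ → refl)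
    (cells-injective {f = cells ∘ row B} {cells ∘ row B′}
      (λ i → length-cells-cong {f = row B i} {row B′ i} (λ _ → refl)) eq i) j)
  where
  row : Matrix m n → Fin m → Fin n → List Bool
  row B i j = List.[ B i j ]

-- Only nonempty blocks are written out, so the number of bits is governed by the weight of the
-- contraction rather than by the area of the matrix.
details : ∀ b → Matrix (m * b) (n * b) → List Bool
details {m} {n} b M =
  cells {m} (λ I → cells {n} (λ J → if nonempty (block b M I J) then entries (block b M I J) else []))

length-details : ∀ b (M : Matrix (m * b) (n * b)) →
                 length (details {m} {n} b M) ≡ b * b * weight (contract {m} {n} b M)
length-details {m} {n} b M = trans (length-cells {m} _)
  (trans (sum-cong-≗ {m} (λ I → trans (length-cells {n} _)
    (trans (sum-cong-≗ {n} (λ J → cell (nonempty (block b M I J)) (block b M I J)))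
           (sym (*-distribˡ-sum (b * b) (χ ∘ contract {m} {n} b M I))))))
  (sym (*-distribˡ-sum (b * b) (λ I → count (contract {m} {n} b M I)))))
  where
  cell : ∀ x (B : Matrix b b) → length (if x then entries B else []) ≡ b * b * χ x
  cell false B = sym (ℕ.*-zeroʳ (b * b))
  cell true  B = trans (length-entries B) (sym (ℕ.*-identityʳ (b * b)))

-- The contraction tells which blocks are nonempty, hence how long each piece is and where to cut.
-- The remaining blocks are identically `false`.
details-injective : ∀ b (M N : Matrix (m * b) (n * b)) →
  (∀ I J → contract {m} {n} b M I J ≡ contract b N I J) → details {m} {n} b M ≡ details {m} {n} b N →
  ∀ x y → M x y ≡ N x y
details-injective {m} {n} b M N same eq x y
  with I , i , refl ← Fin.combine-surjective {m} {b} x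
  with J , j , refl ← Fin.combine-surjective {n} {b} y =
  cell (block b M I J) (block b N I J) (same I J)
    (cells-injective {n} (λ J → same-length (block b M I J) (block b N I J) (same I J))
      (cells-injective {m} (λ I → length-cells-cong {n} λ J → same-length (block b M I J) (block b N I J) (same I J))
        eq I) J) i j
  where
  same-length : (B B′ : Matrix b b) → nonempty B ≡ nonempty B′ →
                length (if nonempty B then entries B else []) ≡ length (if nonempty B′ then entries B′ else [])
  same-length B B′ eq with nonempty B | nonempty B′
  same-length B B′ refl | false | _ = refl
  same-length B B′ refl | true  | _ = trans (length-entries B) (sym (length-entries B′))

  empty : (B : Matrix b b) → nonempty B ≡ false → ∀ i j → B i j ≡ false
  empty B eq i j with B i j in Bij
  ... | false = refl
  ... | true  = contradiction (subst T eq (fromWitness (i , fromWitness (j , subst T (sym Bij) _)))) λ ()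

  cell : (B B′ : Matrix b b) → nonempty B ≡ nonempty B′ →
         (if nonempty B then entries B else []) ≡ (if nonempty B′ then entries B′ else []) →
         ∀ i j → B i j ≡ B′ i j
  cell B B′ same eq i j with nonempty B in e | nonempty B′ in e′
  cell B B′ refl eq i j | true  | _ = entries-injective B B′ eq i j
  cell B B′ refl eq i j | false | _ = trans (empty B e i j) (sym (empty B′ e′ i j))

numeral : List Bool → ℕ
numeral []       = 0
numeral (x ∷ xs) = χ x + 2 * numeral xs

numeral< : ∀ xs → numeral xs < 2 ^ length xs
numeral< []       = s≤s z≤n
numeral< (x ∷ xs) = begin-strict
  χ x + 2 * numeral xs    ≤⟨ ℕ.+-monoˡ-≤ (2 * numeral xs) (χ≤1 x) ⟩
  1 + 2 * numeral xs      <⟨ ℕ.n<1+n _ ⟩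
  2 + 2 * numeral xs      ≡⟨ ℕ.*-suc 2 (numeral xs) ⟨
  2 * suc (numeral xs)    ≤⟨ ℕ.*-monoʳ-≤ 2 (numeral< xs) ⟩
  2 * 2 ^ length xs       ∎
  where open ℕ.≤-Reasoning

-- Equality of lengths excludes strings that differ by trailing `false` digits, which `numeral` does
-- not see.
numeral-injective : ∀ xs ys → length xs ≡ length ys → numeral xs ≡ numeral ys → xs ≡ ys
numeral-injective []       []       _ _  = refl
numeral-injective (x ∷ xs) (y ∷ ys) l eq =
  let x≡y , xs≡ys = digits x y eq in
  cong₂ _∷_ x≡y (numeral-injective xs ys (ℕ.suc-injective l) xs≡ys)
  where
  digits : ∀ x y {a c} → χ x + 2 * a ≡ χ y + 2 * c → x ≡ y × a ≡ c
  digits false false eq = refl , ℕ.*-cancelˡ-≡ _ _ 2 eq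
  digits true  true  eq = refl , ℕ.*-cancelˡ-≡ _ _ 2 (ℕ.suc-injective eq)
  digits false true  {a} {c} eq = contradiction eq (ℕ.even≢odd a c)
  digits true  false {a} {c} eq = contradiction (sym eq) (ℕ.even≢odd c a)

-- Bits per unit of side length: by `weight-linear` the contraction has at most `density k * s`
-- nonempty blocks, each spelled out with `b * b` bits.
rate : ℕ → ℕ
rate k = blockSize k * blockSize k * density k

-- The contraction's code and the details take `D * s` bits each, while the side grows from `s` to
-- at least `2 * s`. The total thus stays linear over all levels.
square-bound : ∀ k D s → 2 ^ (D * s) * 2 ^ (D * s) ≤ 2 ^ (D * (s * blockSize k))
square-bound k D s = begin
  2 ^ (D * s) * 2 ^ (D * s)              ≡⟨ ℕ.^-distribˡ-+-* 2 (D * s) (D * s) ⟨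
  2 ^ (D * s + D * s)                    ≤⟨ ℕ.^-monoʳ-≤ 2 (ℕ.m≤m+n (D * s + D * s) (k * k * (D * s))) ⟩
  2 ^ (D * s + D * s + k * k * (D * s))  ≡⟨ cong (2 ^_) (expand k D s) ⟩
  2 ^ (D * (s * blockSize k))            ∎
  where
  open ℕ.≤-Reasoning
  expand : ∀ k D s → D * s + D * s + k * k * (D * s) ≡ D * (s * (2 + k * k))
  expand = solve-∀

code : (π : Permutation′ (suc k)) → ∀ t (M : SquareMatrix (blockSize k) t) → ¬ Occurs M π →
       Fin (2 ^ (rate k * size (blockSize k) t))
code {k} π zero M avoids = inject≤ (fromℕ< (s≤s (χ≤1 (M zero zero)))) (ℕ.^-monoʳ-≤ 2 {1} {rate k * 1} (s≤s z≤n))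
code {k} π (suc t) M avoids =
  inject≤ (combine (code π t (contract b M) avoids′) (fromℕ< (ℕ.<-≤-trans (numeral< (details {s} {s} b M)) details-bound)))
          (square-bound k D s)
  where
  b = blockSize k
  s = size b t
  D = rate k

  avoids′ : ¬ Occurs (contract {s} {s} b M) π
  avoids′ = avoids ∘ occurs-contract b M π

  details-bound : 2 ^ length (details {s} {s} b M) ≤ 2 ^ (D * s)
  details-bound = ℕ.^-monoʳ-≤ 2 (begin
    length (details {s} {s} b M)                   ≡⟨ length-details {s} {s} b M ⟩
    b * b * weight (contract {s} {s} b M)  ≤⟨ ℕ.*-monoʳ-≤ (b * b) (weight-linear π t (contract b M) avoids′) ⟩
    b * b * (density k * s)                ≡⟨ ℕ.*-assoc (b * b) (density k) s ⟨
    D * s                                  ∎)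
    where open ℕ.≤-Reasoning

-- Decoding goes from coarse to fine: the first component gives the contraction, and this with the
-- details gives the matrix. Hence the number of avoiding matrices is at most exponential in the
-- side, which is the Stanley-Wilf bound.
code-injective : (π : Permutation′ (suc k)) → ∀ t (M N : SquareMatrix (blockSize k) t)
                 (avoidsM : ¬ Occurs M π) (avoidsN : ¬ Occurs N π) →
                 code π t M avoidsM ≡ code π t N avoidsN → ∀ x y → M x y ≡ N x y
code-injective π zero M N _ _ eq zero zero = χ-injective _ _
  (Fin.fromℕ<-injective _ _ _ _ (Fin.inject≤-injective _ _ _ _ eq))
  where
  χ-injective : ∀ x y → χ x ≡ χ y → x ≡ y
  χ-injective false false _ = refl
  χ-injective true  true  _ = refl
code-injective {k} π (suc t) M N avoidsM avoidsN eq =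
  details-injective {s} {s} b M N contract≗
    (numeral-injective (details {s} {s} b M) (details {s} {s} b N) lengths
      (Fin.fromℕ<-injective _ _ _ _ (proj₂ codes)))
  where
  b = blockSize k
  s = size b t

  codes = Fin.combine-injective _ _ _ _ (Fin.inject≤-injective _ _ _ _ eq)

  contract≗ : ∀ I J → contract {s} {s} b M I J ≡ contract {s} {s} b N I J
  contract≗ = code-injective π t (contract b M) (contract b N) _ _ (proj₁ codes)

  -- The numeral determines the details only when their length is known, and that length is read off
  -- from the contraction.
  lengths : length (details {s} {s} b M) ≡ length (details {s} {s} b N)
  lengths = trans (length-details {s} {s} b M)
    (trans (cong (b * b *_) (sum-cong-≗ {s} λ I → sum-cong-≗ {s} λ J → cong χ (contract≗ I J)))
           (sym (length-details {s} {s} b N)))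

-- Sorting a permutation by colour

#below : (Fin n → ℕ) → ℕ → ℕ
#below key a = count (λ y → key y <ᵇ a)

#below-mono-≤ : ∀ (key : Fin n → ℕ) {a c} → a ≤ c → #below key a ≤ #below key c
#below-mono-≤ key {a} {c} a≤c = sum-mono-≤ (λ y →
  χ-mono {key y <ᵇ a} {key y <ᵇ c} (λ t → ℕ.<⇒<ᵇ (ℕ.<-≤-trans (ℕ.<ᵇ⇒< (key y) _ t) a≤c)))

χ-< : ∀ {x y} → ¬ T x → T y → χ x < χ y
χ-< {false} {true} _ _ = s≤s z≤n
χ-< {true}         ¬x _ = contradiction _ ¬x

#below-mono-< : ∀ (key : Fin n → ℕ) x {c} → key x < c → #below key (key x) < #below key c
#below-mono-< key x {c} x<c = sum-mono-<
  (λ y → χ-mono {key y <ᵇ key x} {key y <ᵇ c} (λ t → ℕ.<⇒<ᵇ (ℕ.<-trans (ℕ.<ᵇ⇒< (key y) _ t) x<c)))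
  x (χ-< {key x <ᵇ key x} (λ t → ℕ.<-irrefl refl (ℕ.<ᵇ⇒< (key x) _ t)) (ℕ.<⇒<ᵇ x<c))

#below<n : ∀ (key : Fin n → ℕ) x → #below key (key x) < n
#below<n {n} key x = subst (#below key (key x) <_) (trans (sum-const n 1) (ℕ.*-identityʳ n))
  (sum-mono-< (λ y → χ≤1 (key y <ᵇ key x)) x
    (χ-< {key x <ᵇ key x} {true} (λ t → ℕ.<-irrefl refl (ℕ.<ᵇ⇒< (key x) _ t)) _))

rank : (Fin n → ℕ) → Fin n → Fin n
rank key x = fromℕ< (#below<n key x)

toℕ-rank : ∀ (key : Fin n → ℕ) x → toℕ (rank key x) ≡ #below key (key x)
toℕ-rank key x = Fin.toℕ-fromℕ< (#below<n key x)

rank-cancel-< : ∀ (key : Fin n → ℕ) x y → toℕ (rank key x) < toℕ (rank key y) → key x < key y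
rank-cancel-< key x y rx<ry = ℕ.≰⇒> λ y≤x → ℕ.<⇒≱ rx<ry
  (subst₂ _≤_ (sym (toℕ-rank key y)) (sym (toℕ-rank key x)) (#below-mono-≤ key y≤x))

rank-injective : ∀ (key : Fin n → ℕ) → (∀ {x y} → key x ≡ key y → x ≡ y) →
                 ∀ {x y} → rank key x ≡ rank key y → x ≡ y
rank-injective key key-injective {x} {y} eq with ℕ.<-cmp (key x) (key y)
... | tri≈ _ kx≡ky _ = key-injective kx≡ky
... | tri< kx<ky _ _ = contradiction (#below-mono-< key x kx<ky) (ℕ.<-irrefl
        (trans (sym (toℕ-rank key x)) (trans (cong toℕ eq) (toℕ-rank key y))))
... | tri> _ _ ky<kx = contradiction (#below-mono-< key y ky<kx) (ℕ.<-irrefl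
        (trans (sym (toℕ-rank key y)) (trans (cong toℕ (sym eq)) (toℕ-rank key x))))

-- `combine` puts the colour in the leading digit, so keys compare by colour first and by index
-- within a colour.
lexKey : (Fin n → Fin N) → Fin n → ℕ
lexKey c x = toℕ (combine (c x) x)

lexKey-injective : ∀ (c : Fin n → Fin N) {x y} → lexKey c x ≡ lexKey c y → x ≡ y
lexKey-injective c {x} {y} eq = Fin.combine-injectiveʳ (c x) x (c y) y (Fin.toℕ-injective eq)

lexKey-colour : ∀ (c : Fin n → Fin N) x y → lexKey c x < lexKey c y → c x Fin.≤ c y
lexKey-colour c x y lt = ℕ.≮⇒≥ λ cy<cx → ℕ.<-asym lt (Fin.combine-monoˡ-< y x cy<cx)

lexKey-within : ∀ (c : Fin n → Fin N) x y → c x ≡ c y → lexKey c x < lexKey c y → x Fin.< y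
lexKey-within {n} c x y cx≡cy lt = ℕ.+-cancelˡ-< (n * toℕ (c x)) _ _
  (subst₂ _<_ (Fin.toℕ-combine (c x) x)
              (trans (Fin.toℕ-combine (c y) y) (cong (λ z → n * toℕ z + toℕ y) (sym cx≡cy))) lt)

-- The rank in the sorted order, embedded in a side `m` that will be a power of the block size; the
-- additional rows and columns of the matrix stay empty.
position : n ≤ m → (Fin n → Fin N) → Fin n → Fin m
position n≤m c x = inject≤ (rank (lexKey c) x) n≤m

position-cancel-< : (n≤m : n ≤ m) (c : Fin n → Fin N) → ∀ x y →
                    position n≤m c x Fin.< position n≤m c y → lexKey c x < lexKey c y
position-cancel-< n≤m c x y lt = rank-cancel-< (lexKey c) x y
  (subst₂ _<_ (Fin.toℕ-inject≤ _ n≤m) (Fin.toℕ-inject≤ _ n≤m) lt)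

position-injective : (n≤m : n ≤ m) (c : Fin n → Fin N) → ∀ {x y} →
                     position n≤m c x ≡ position n≤m c y → x ≡ y
position-injective n≤m c eq = rank-injective (lexKey c) (lexKey-injective c)
  (Fin.inject≤-injective n≤m n≤m _ _ eq)

-- A value inherits the colour of the position that `σ` maps to it, so every entry of the sorted
-- matrix joins equal colours.
valueColour : (Fin n → Fin N) → Permutation′ n → Fin n → Fin N
valueColour c σ y = c (σ ⟨$⟩ˡ y)

-- The permutation matrix of σ with positions and values sorted by colour
-- first: its blocks on the diagonal are the restrictions of σ to the colour
-- classes.
sortedMatrix : n ≤ m → (Fin n → Fin N) → Permutation′ n → Matrix m m
sortedMatrix n≤m c σ r s = ⌊ Fin.any? (λ x →
  (position n≤m c x Fin.≟ r) ×-dec (position n≤m (valueColour c σ) (σ ⟨$⟩ʳ x) Fin.≟ s)) ⌋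

-- Positions are sorted by `c` alone and values by their colours alone. Once the value colours
-- agree, both sortings are the same for `σ` and `τ` and can be undone.
sortedMatrix-injective : (n≤m : n ≤ m) (c : Fin n → Fin N) (σ τ : Permutation′ n) →
  (∀ y → valueColour c σ y ≡ valueColour c τ y) →
  (∀ r s → sortedMatrix n≤m c σ r s ≡ sortedMatrix n≤m c τ r s) → ∀ x → σ ⟨$⟩ʳ x ≡ τ ⟨$⟩ʳ x
sortedMatrix-injective n≤m c σ τ same eq x =
  -- The entry that `x` contributes for `σ` must also come from some `x′` for `τ`, and its row
  -- forces `x′` to be `x`.
  let x′ , px , py = toWitness (subst T (eq _ _) (fromWitness (x , refl , refl)))
      x′≡x         = position-injective n≤m c px
  in position-injective n≤m (valueColour c σ) (trans (sym py)
       (trans (position-cong (sym ∘ same) (τ ⟨$⟩ʳ x′)) (cong (position n≤m (valueColour c σ) ∘ (τ ⟨$⟩ʳ_)) x′≡x)))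
  where
  position-cong : ∀ {c d : Fin _ → Fin _} → (∀ y → c y ≡ d y) → ∀ y → position n≤m c y ≡ position n≤m d y
  position-cong {c} {d} c≗d y = Fin.toℕ-injective (trans (Fin.toℕ-inject≤ _ n≤m) (trans
    (trans (toℕ-rank (lexKey c) y) (trans (sum-cong-≗ λ z → cong₂ (λ a e → χ (a <ᵇ e)) (key≗ z) (key≗ y))
      (sym (toℕ-rank (lexKey d) y)))) (sym (Fin.toℕ-inject≤ _ n≤m))))
    where
    key≗ : ∀ z → lexKey c z ≡ lexKey d z
    key≗ z = cong (λ a → toℕ (combine a z)) (c≗d z)

PatternIn : (Fin n → Fin N) → Permutation′ k → Permutation′ n → Set
PatternIn {n} {N} {k} c π σ = ∃[ xs ] (Increasing {k} {n} xs × (∃[ p ] ∀ i → c (xs i) ≡ p) ×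
  (∀ i j → (π ⟨$⟩ʳ i Fin.< π ⟨$⟩ʳ j) ⇔ (σ ⟨$⟩ʳ xs i Fin.< σ ⟨$⟩ʳ xs j)))

withMaximum : Permutation′ k → Permutation′ (suc k)
withMaximum {k} = insert zero (Fin.fromℕ k)

-- Prepending a maximum makes the pattern indecomposable, so that it occurs
-- inside a single diagonal block.
pattern-in-block : (n≤m : n ≤ m) (c : Fin n → Fin N) (π : Permutation′ k) (σ : Permutation′ n) →
                   Occurs (sortedMatrix n≤m c σ) (withMaximum π) → PatternIn c π σ
pattern-in-block {n} {m} {N} {k} n≤m c π σ (rs , ss , rs↑ , ss↑ , hits) =
  x ∘ suc , within , (c (x zero) , same) , λ i j → mk⇔ (forward i j) (backward i j)
  where
  ρ = withMaximum π
  d = valueColour c σ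

  witness : ∀ i → ∃[ x ] (position n≤m c x ≡ rs i × position n≤m d (σ ⟨$⟩ʳ x) ≡ ss (ρ ⟨$⟩ʳ i))
  witness i = toWitness (hits i)

  x : Fin (suc k) → Fin n
  x i = proj₁ (witness i)

  y : Fin (suc k) → Fin n
  y i = σ ⟨$⟩ʳ x i

  d≡c : ∀ i → d (y i) ≡ c (x i)
  d≡c i = cong c (Perm.inverseˡ σ)

  rows : ∀ i j → i Fin.< j → lexKey c (x i) < lexKey c (x j)
  rows i j i<j = position-cancel-< n≤m c (x i) (x j)
    (subst₂ Fin._<_ (sym (proj₁ (proj₂ (witness i)))) (sym (proj₁ (proj₂ (witness j)))) (rs↑ i j i<j))

  columns : ∀ i j → ρ ⟨$⟩ʳ i Fin.< ρ ⟨$⟩ʳ j → lexKey d (y i) < lexKey d (y j)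
  columns i j i<j = position-cancel-< n≤m d (y i) (y j)
    (subst₂ Fin._<_ (sym (proj₂ (proj₂ (witness i)))) (sym (proj₂ (proj₂ (witness j)))) (ss↑ _ _ i<j))

  max : ∀ i → ρ ⟨$⟩ʳ suc i Fin.< ρ ⟨$⟩ʳ zero
  max i = ℕ.≤∧≢⇒< (Fin.≤fromℕ _) (Fin.punchInᵢ≢i (Fin.fromℕ k) (π ⟨$⟩ʳ i) ∘ Fin.toℕ-injective)

  -- The prepended entry comes first, so its colour is at most every other. It also has the largest
  -- value, so its colour is at least every other.
  same : ∀ i → c (x (suc i)) ≡ c (x zero)
  same i = Fin.≤-antisym
    (subst₂ Fin._≤_ (d≡c (suc i)) (d≡c zero) (lexKey-colour d (y (suc i)) (y zero) (columns (suc i) zero (max i))))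
    (lexKey-colour c (x zero) (x (suc i)) (rows zero (suc i) (s≤s z≤n)))

  same₂ : ∀ i j → c (x (suc i)) ≡ c (x (suc j))
  same₂ i j = trans (same i) (sym (same j))

  within : Increasing (x ∘ suc)
  within i j i<j = lexKey-within c _ _ (same₂ i j) (rows (suc i) (suc j) (s≤s i<j))

  -- Within one colour the sorted order of values is their true order, and `punchIn` preserves the
  -- order of the values of `π`.
  forward : ∀ i j → π ⟨$⟩ʳ i Fin.< π ⟨$⟩ʳ j → y (suc i) Fin.< y (suc j)
  forward i j i<j = lexKey-within d _ _ (trans (d≡c (suc i)) (trans (same₂ i j) (sym (d≡c (suc j)))))
    (columns (suc i) (suc j) (ℕ.≰⇒> λ j≤i → ℕ.<⇒≱ i<j
      (Fin.punchIn-cancel-≤ (Fin.fromℕ k) (π ⟨$⟩ʳ j) (π ⟨$⟩ʳ i) j≤i)))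

  backward : ∀ i j → y (suc i) Fin.< y (suc j) → π ⟨$⟩ʳ i Fin.< π ⟨$⟩ʳ j
  backward i j i<j with Fin.<-cmp (π ⟨$⟩ʳ i) (π ⟨$⟩ʳ j)
  ... | tri< lt _ _ = lt
  ... | tri> _ _ gt = contradiction (forward j i gt) (ℕ.<-asym i<j)
  ... | tri≈ _ eq _ with refl ← trans (sym (Perm.inverseˡ π)) (trans (cong (π ⟨$⟩ˡ_) eq) (Perm.inverseˡ π)) =
    contradiction i<j (ℕ.<-irrefl refl)

-- Cliques

x∈image⁻ : ∀ {x} (xs : Vec (Fin n) k) → x ∈ image xs → ∃[ i ] lookup xs i ≡ x
x∈image⁻ []       x∈ = contradiction x∈ ∉⊥
x∈image⁻ (y ∷ xs) x∈ with x∈p∪q⁻ ⁅ y ⁆ (image xs) x∈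
... | inj₁ x∈y  = zero , sym (x∈⁅y⁆⇒x≡y _ x∈y)
... | inj₂ x∈xs = let i , eq = x∈image⁻ xs x∈xs in suc i , eq

∣⁅x⁆∪p∣ : ∀ {x} (p : Subset n) → x ∉ p → ∣ ⁅ x ⁆ ∪ p ∣ ≡ suc ∣ p ∣
∣⁅x⁆∪p∣ {x = zero}  (inside  ∷ p) x∉p = contradiction here x∉p
∣⁅x⁆∪p∣ {x = zero}  (outside ∷ p) x∉p = cong (suc ∘ ∣_∣) (∪-identityˡ p)
∣⁅x⁆∪p∣ {x = suc x} (inside  ∷ p) x∉p = cong suc (∣⁅x⁆∪p∣ p (x∉p ∘ there))
∣⁅x⁆∪p∣ {x = suc x} (outside ∷ p) x∉p = ∣⁅x⁆∪p∣ p (x∉p ∘ there)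

∣image∣ : (xs : Vec (Fin n) k) → Increasing (lookup xs) → ∣ image xs ∣ ≡ k
∣image∣ {n} []       inc = ∣⊥∣≡0 n
∣image∣     (x ∷ xs) inc = trans
  (∣⁅x⁆∪p∣ (image xs) λ x∈ → let i , eq = x∈image⁻ xs x∈ in
    ℕ.<-irrefl (cong toℕ (sym eq)) (inc zero (suc i) (s≤s z≤n)))
  (cong suc (∣image∣ xs (λ i j i<j → inc (suc i) (suc j) (s≤s i<j))))

-- All vertices of colour `p` lie in the clique `S p`, so the positions of a monochromatic
-- occurrence form a `k`-subset of a clique and hence an edge.
contains-in-clique : ∀ {L} (Λ : UniformHypergraph k n) (S : Fin N → Subset n) → (∀ p → IsClique Λ L (S p)) →
                     (c : Fin n → Fin N) → (∀ v → v ∈ S (c v)) → (π : Permutation′ k) (σ : Permutation′ n) →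
                     PatternIn c π σ → Contains Λ π σ
contains-in-clique {k} {n} Λ S cliques c c∈ π σ (xs , xs↑ , (p , same) , order) =
  v , v↑ , proj₂ (cliques p) (image v) image⊆ (∣image∣ v v↑) ,
  λ i j → subst₂ (λ a e → (π ⟨$⟩ʳ i Fin.< π ⟨$⟩ʳ j) ⇔ (σ ⟨$⟩ʳ a Fin.< σ ⟨$⟩ʳ e)) (sym (v≗ i)) (sym (v≗ j)) (order i j)
  where
  v : Vec (Fin n) k
  v = Vec.tabulate xs

  v≗ : ∀ i → lookup v i ≡ xs i
  v≗ = lookup∘tabulate xs

  v↑ : Increasing (lookup v)
  v↑ i j i<j = subst₂ Fin._<_ (sym (v≗ i)) (sym (v≗ j)) (xs↑ i j i<j)

  image⊆ : image v ⊆ S p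
  image⊆ x∈ with i , refl ← x∈image⁻ v x∈ =
    subst (λ z → lookup v i ∈ S z) (trans (cong c (v≗ i)) (same i)) (c∈ (lookup v i))

-- Counting avoiding permutations through injective codes.

allPairs-lookup : ∀ {A : Set} {R : A → A → Set} {xs : List A} → AllPairs R xs →
                  ∀ {i j} → i Fin.< j → R (List.lookup xs i) (List.lookup xs j)
allPairs-lookup (rs ∷ _)  {zero}  {suc j} _   = All.lookup rs (∈-lookup j)
allPairs-lookup (_  ∷ ps) {suc i} {suc j} i<j = allPairs-lookup ps (ℕ.s≤s⁻¹ i<j)

-- A pigeonhole bound. The code may depend on the proof of `P`, so injectivity is asked for
-- arbitrary proofs and only up to `R`.
length-by-code : ∀ {A : Set} {P : A → Set} {R : A → A → Set} {xs : List A} →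
                 (f : ∀ a → P a → Fin n) → (∀ {a b} p q → f a p ≡ f b q → R a b) →
                 All P xs → AllPairs (λ a b → ¬ R a b) xs → length xs ≤ n
length-by-code {n} {xs = xs} f injective ps distinct = Fin.injective⇒≤ {f = g} g-injective
  where
  g : Fin (length xs) → Fin n
  g i = f (List.lookup xs i) (All.lookup ps (∈-lookup i))

  g-injective : ∀ {i j} → g i ≡ g j → i ≡ j
  g-injective {i} {j} eq with Fin.<-cmp i j
  ... | tri≈ _ i≡j _ = i≡j
  ... | tri< i<j _ _ = contradiction (injective _ _ eq) (allPairs-lookup distinct i<j)
  ... | tri> _ _ j<i = contradiction (injective _ _ (sym eq)) (allPairs-lookup distinct j<i)

-- The code of `σ` pairs its value colouring with the code of its sorted matrix. The matrix avoids a
-- pattern of length `suc k`, which is why the constants at `k` appear.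
avoidingCount≤ : ∀ {L} (Λ : UniformHypergraph k n) (S : Fin N → Subset n) → (∀ p → IsClique Λ L (S p)) →
  (c : Fin n → Fin N) → (∀ v → v ∈ S (c v)) → (π : Permutation′ k) →
  ∀ t → n ≤ size (blockSize k) t → avoidingCount Λ π ≤ N ^ n * 2 ^ (rate k * size (blockSize k) t)
avoidingCount≤ {k} {n} {N} Λ S cliques c c∈ π t n≤m =
  length-by-code {R = Perm._≈_} encode (λ {σ} {τ} → encode-injective {σ} {τ})
                 (All.all-filter (avoids? Λ π) (permutations n))
                 (AllPairs.filter⁺ (avoids? Λ π) (permutations-unique n))
  where
  ρ = withMaximum π

  avoids-sorted : ∀ σ → Avoids Λ π σ → ¬ Occurs (sortedMatrix n≤m c σ) ρ
  avoids-sorted σ avoids = avoids ∘ contains-in-clique Λ S cliques c c∈ π σ ∘ pattern-in-block n≤m c π σ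

  encode : ∀ σ → Avoids Λ π σ → Fin (N ^ n * 2 ^ (rate k * size (blockSize k) t))
  encode σ avoids = combine (funToFin (valueColour c σ)) (code ρ t (sortedMatrix n≤m c σ) (avoids-sorted σ avoids))

  encode-injective : ∀ {σ τ} p q → encode σ p ≡ encode τ q → σ Perm.≈ τ
  encode-injective {σ} {τ} p q eq = sortedMatrix-injective n≤m c σ τ
    (λ y → trans (sym (Fin.finToFun-funToFin (valueColour c σ) y))
      (trans (cong (λ w → Fin.finToFun w y) (proj₁ codes)) (Fin.finToFun-funToFin (valueColour c τ) y)))
    (code-injective ρ t _ _ _ _ (proj₂ codes))
    where codes = Fin.combine-injective _ _ _ _ eq

-- Padding the side to a power of the block size costs only a constant factor. The exponent is
-- raised exactly when the next `n` exceeds the current power.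
size-between : ∀ k n → .{{NonZero k}} → .{{NonZero n}} →
               ∃[ t ] (n ≤ size (blockSize k) t × size (blockSize k) t ≤ blockSize k * n)
size-between k 1             = 0 , ℕ.≤-refl , s≤s z≤n
size-between k (suc (suc n)) with size-between k (suc n)
... | t , lower , upper with suc (suc n) ℕ.≤? size (blockSize k) t
...   | yes larger = t , larger , ℕ.≤-trans upper (ℕ.*-monoʳ-≤ (blockSize k) (ℕ.n≤1+n (suc n)))
...   | no ¬larger = suc t , above , below
  where
  open ℕ.≤-Reasoning
  s≤ : size (blockSize k) t ≤ suc n
  s≤ = ℕ.s≤s⁻¹ (ℕ.≰⇒> ¬larger)

  above : suc (suc n) ≤ size (blockSize k) t * blockSize k
  above = begin
    suc (suc n)                  ≤⟨ s≤s (s≤s (ℕ.m≤m+n n (n + 0))) ⟩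
    2 + (n + (n + 0))            ≡⟨ ℕ.*-suc 2 n ⟨
    2 * suc n                    ≡⟨ ℕ.*-comm 2 (suc n) ⟩
    suc n * 2                    ≤⟨ ℕ.*-mono-≤ lower (ℕ.m≤m+n 2 (k * k)) ⟩
    size (blockSize k) t * blockSize k ∎

  below : size (blockSize k) t * blockSize k ≤ blockSize k * suc (suc n)
  below = begin
    size (blockSize k) t * blockSize k  ≡⟨ ℕ.*-comm (size (blockSize k) t) (blockSize k) ⟩
    blockSize k * size (blockSize k) t  ≤⟨ ℕ.*-monoʳ-≤ (blockSize k) (ℕ.≤-trans s≤ (ℕ.n≤1+n _)) ⟩
    blockSize k * suc (suc n)           ∎

-- Double counting of vertices and cliques.

∣∣≡count : (S : Subset n) → ∣ S ∣ ≡ count (λ v → does (v ∈? S))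
∣∣≡count []            = refl
∣∣≡count (inside  ∷ S) = cong suc (∣∣≡count S)
∣∣≡count (outside ∷ S) = ∣∣≡count S

degree-∷ : ∀ S (𝒞 : List (Subset n)) v → degree (S ∷ 𝒞) v ≡ χ (does (v ∈? S)) + degree 𝒞 v
degree-∷ S 𝒞 v with does (v ∈? S)
... | true  = refl
... | false = refl

double-counting : ∀ {L} (𝒞 : List (Subset n)) → All (λ S → ∣ S ∣ ≡ L) 𝒞 → length 𝒞 * L ≡ sum (degree 𝒞)
double-counting {n} []       []            = sym (trans (sum-const n 0) (ℕ.*-zeroʳ n))
double-counting     (S ∷ 𝒞) (refl ∷ sizes) = begin
  ∣ S ∣ + length 𝒞 * ∣ S ∣                          ≡⟨ cong₂ _+_ (∣∣≡count S) (double-counting 𝒞 sizes) ⟩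
  count (λ v → does (v ∈? S)) + sum (degree 𝒞)      ≡⟨ ∑-distrib-+ (λ v → χ (does (v ∈? S))) (degree 𝒞) ⟨
  sum (λ v → χ (does (v ∈? S)) + degree 𝒞 v)        ≡⟨ sum-cong-≗ (degree-∷ S 𝒞) ⟨
  sum (degree (S ∷ 𝒞))                              ∎
  where open ≡-Reasoning

positive-degree⇒Any : ∀ (𝒞 : List (Subset n)) v → 0 < degree 𝒞 v → Any (v ∈_) 𝒞
positive-degree⇒Any 𝒞 v pos with Any.any? (v ∈?_) 𝒞
... | yes v∈ = v∈
... | no  v∉ = contradiction (subst (0 <_) (cong length (List.filter-none (v ∈?_) (All.¬Any⇒All¬ 𝒞 v∉))) pos) λ ()

growth : ℕ → ℕ
growth k = 2 ^ (rate k * blockSize k)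

-- There is one colour per clique of the collection. The factor `L ^ n` stands on the left so that
-- the estimate stays in the natural numbers.
avoidingCount-bound : ∀ {L Δ} → .{{NonZero k}} → .{{NonZero n}} →
  (Λ : UniformHypergraph k n) (𝒞 : List (Subset n)) → All (IsClique Λ L) 𝒞 →
  (∀ v → 0 < degree 𝒞 v) → (∀ v → degree 𝒞 v ≤ Δ) → (π : Permutation′ k) →
  avoidingCount Λ π * L ^ n ≤ (n * Δ * growth k) ^ n
avoidingCount-bound {k} {n} {L} {Δ} Λ 𝒞 cliques pos bounded π = begin
  avoidingCount Λ π * L ^ n
    ≤⟨ ℕ.*-monoˡ-≤ (L ^ n) (avoidingCount≤ Λ (List.lookup 𝒞) (λ p → All.lookup cliques (∈-lookup p)) c c∈ π t n≤m) ⟩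
  #𝒞 ^ n * 2 ^ (rate k * M) * L ^ n
    ≤⟨ ℕ.*-monoˡ-≤ (L ^ n) (ℕ.*-monoʳ-≤ (#𝒞 ^ n) (ℕ.^-monoʳ-≤ 2 (ℕ.*-monoʳ-≤ (rate k) m≤))) ⟩
  #𝒞 ^ n * 2 ^ (rate k * (blockSize k * n)) * L ^ n
    ≡⟨ cong (λ e → #𝒞 ^ n * e * L ^ n) (trans (cong (2 ^_) (sym (ℕ.*-assoc (rate k) (blockSize k) n))) (sym (ℕ.^-*-assoc 2 (rate k * blockSize k) n))) ⟩
  #𝒞 ^ n * growth k ^ n * L ^ n
    ≡⟨ cong (_* L ^ n) (^-distribʳ-* n #𝒞 (growth k)) ⟨
  (#𝒞 * growth k) ^ n * L ^ n
    ≡⟨ ^-distribʳ-* n (#𝒞 * growth k) L ⟨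
  (#𝒞 * growth k * L) ^ n
    ≤⟨ ℕ.^-monoˡ-≤ n #𝒞*L≤ ⟩
  (n * Δ * growth k) ^ n ∎
  where
  open ℕ.≤-Reasoning
  #𝒞 = length 𝒞
  t = proj₁ (size-between k n)
  M = size (blockSize k) t
  n≤m = proj₁ (proj₂ (size-between k n))
  m≤ = proj₂ (proj₂ (size-between k n))

  ^-distribʳ-* : ∀ n a c → (a * c) ^ n ≡ a ^ n * c ^ n
  ^-distribʳ-* zero    a c = refl
  ^-distribʳ-* (suc n) a c = trans (cong (a * c *_) (^-distribʳ-* n a c)) (swap a c (a ^ n) (c ^ n))
    where
    swap : ∀ a c x y → a * c * (x * y) ≡ a * x * (c * y)
    swap = solve-∀

  -- Positive degree provides a clique through `v`; its index in the collection is the colour.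
  c : Fin n → Fin #𝒞
  c v = Any.index (positive-degree⇒Any 𝒞 v (pos v))

  c∈ : ∀ v → v ∈ List.lookup 𝒞 (c v)
  c∈ v = lookup-index (positive-degree⇒Any 𝒞 v (pos v))

  #𝒞*L≤ : #𝒞 * growth k * L ≤ n * Δ * growth k
  #𝒞*L≤ = begin
    #𝒞 * growth k * L      ≡⟨ swap #𝒞 (growth k) L ⟩
    #𝒞 * L * growth k      ≡⟨ cong (_* growth k) (double-counting 𝒞 (All.map proj₁ cliques)) ⟩
    sum (degree 𝒞) * growth k  ≤⟨ ℕ.*-monoˡ-≤ (growth k) (sum-bounded bounded) ⟩
    n * Δ * growth k      ∎
    where
    swap : ∀ a g l → a * g * l ≡ a * l * g
    swap = solve-∀

-- Rational bounds

≤⇒≯ : ∀ {p q} → p ℚ.≤ q → ¬ q ℚ.< p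
≤⇒≯ p≤q q<p = ℚ.<-irrefl refl (ℚ.<-≤-trans q<p p≤q)

-- The division in `ℕ→ℚ` normalises by a gcd that is stuck on variables; `fromℤ` exposes numerator
-- and denominator.
ℕ→ℚ≡fromℤ : ∀ m → ℕ→ℚ m ≡ fromℤ (ℤ.+ m)
ℕ→ℚ≡fromℤ m = ℚ.↥p/↧p≡p (fromℤ (ℤ.+ m))

ℕ→ℚ-mono-< : ∀ {a c} → a ℕ.< c → ℕ→ℚ a ℚ.< ℕ→ℚ c
ℕ→ℚ-mono-< {a} {c} a<c = subst₂ ℚ._<_ (sym (ℕ→ℚ≡fromℤ a)) (sym (ℕ→ℚ≡fromℤ c))
  (*<* (ℤ.*-monoʳ-<-pos (ℤ.+ 1) (ℤ.+<+ a<c)))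

ℕ→ℚ-mono-≤ : ∀ {a c} → a ≤ c → ℕ→ℚ a ℚ.≤ ℕ→ℚ c
ℕ→ℚ-mono-≤ {a} {c} a≤c = subst₂ ℚ._≤_ (sym (ℕ→ℚ≡fromℤ a)) (sym (ℕ→ℚ≡fromℤ c))
  (*≤* (ℤ.*-monoʳ-≤-nonNeg (ℤ.+ 1) (ℤ.+≤+ a≤c)))

ℕ→ℚ-cancel-< : ∀ {a c} → ℕ→ℚ a ℚ.< ℕ→ℚ c → a ℕ.< c
ℕ→ℚ-cancel-< a<c = ℕ.≰⇒> λ c≤a → ≤⇒≯ (ℕ→ℚ-mono-≤ c≤a) a<c

ℕ→ℚ-suc : ∀ m → ℕ→ℚ (suc m) ≡ 1ℚ ℚ.+ ℕ→ℚ m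
ℕ→ℚ-suc m = sym (trans (cong (1ℚ ℚ.+_) (ℕ→ℚ≡fromℤ m)) (cong (ℚ._/ 1) (cong (λ i → ℤ.1ℤ ℤ.+ i) (ℤ.*-identityʳ (ℤ.+ m)))))

ℕ→ℚ-* : ∀ a c → ℕ→ℚ (a ℕ.* c) ≡ ℕ→ℚ a ℚ.* ℕ→ℚ c
ℕ→ℚ-* a c = sym (trans (cong₂ ℚ._*_ (ℕ→ℚ≡fromℤ a) (ℕ→ℚ≡fromℤ c)) (cong (ℚ._/ 1) (sym (ℤ.pos-* a c))))

ℕ→ℚ-^ : ∀ a n → ℕ→ℚ (a ℕ.^ n) ≡ ℕ→ℚ a ^ℚ n
ℕ→ℚ-^ a zero    = refl
ℕ→ℚ-^ a (suc n) = trans (ℕ→ℚ-* a (a ℕ.^ n)) (cong (ℕ→ℚ a ℚ.*_) (ℕ→ℚ-^ a n))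

0≤ℕ→ℚ : ∀ m → 0ℚ ℚ.≤ ℕ→ℚ m
0≤ℕ→ℚ m = ℕ→ℚ-mono-≤ {0} {m} z≤n

0<ℕ→ℚsuc : ∀ m → 0ℚ ℚ.< ℕ→ℚ (suc m)
0<ℕ→ℚsuc m = ℕ→ℚ-mono-< {0} {suc m} (s≤s z≤n)

-- The absolute value of the numerator: a crude natural upper bound, not the least one.
ceil : ℚ → ℕ
ceil q = ℤ.∣ ↥ q ∣

q≤ceil : ∀ q → q ℚ.≤ ℕ→ℚ (ceil q)
q≤ceil q = subst (q ℚ.≤_) (sym (ℕ→ℚ≡fromℤ (ceil q))) (*≤* (begin
  ↥ q ℤ.* ℤ.+ 1               ≡⟨ ℤ.*-identityʳ (↥ q) ⟩
  ↥ q                          ≤⟨ i≤∣i∣ (↥ q) ⟩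
  ℤ.+ ceil q                   ≡⟨ cong ℤ.+_ (ℕ.*-identityʳ (ceil q)) ⟨
  ℤ.+ (ceil q ℕ.* 1)           ≤⟨ ℤ.+≤+ (ℕ.*-monoʳ-≤ (ceil q) (s≤s z≤n)) ⟩
  ℤ.+ (ceil q ℕ.* ↧ₙ q)        ≡⟨ ℤ.pos-* (ceil q) (↧ₙ q) ⟩
  ℤ.+ ceil q ℤ.* ↧ q           ∎))
  where
  open ℤ.≤-Reasoning
  i≤∣i∣ : ∀ i → i ℤ.≤ ℤ.+ ℤ.∣ i ∣
  i≤∣i∣ (ℤ.+ n)      = ℤ.≤-refl
  i≤∣i∣ (ℤ.-[1+ n ]) = ℤ.-≤+

^ℚ-nonNegative : ∀ {x} n → 0ℚ ℚ.≤ x → 0ℚ ℚ.≤ x ^ℚ n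
^ℚ-nonNegative         zero    0≤x = ℚ.nonNegative⁻¹ 1ℚ
^ℚ-nonNegative {x} (suc n) 0≤x = subst (ℚ._≤ x ℚ.* x ^ℚ n) (ℚ.*-zeroʳ x)
  (ℚ.*-monoˡ-≤-nonNeg x {{ℚ.nonNegative 0≤x}} (^ℚ-nonNegative n 0≤x))

*ℚ-mono-≤ : ∀ {a c d e} → 0ℚ ℚ.≤ a → 0ℚ ℚ.≤ d → a ℚ.≤ c → d ℚ.≤ e → a ℚ.* d ℚ.≤ c ℚ.* e
*ℚ-mono-≤ {a} {c} {d} 0≤a 0≤d a≤c d≤e = ℚ.≤-trans
  (ℚ.*-monoʳ-≤-nonNeg d {{ℚ.nonNegative 0≤d}} a≤c)
  (ℚ.*-monoˡ-≤-nonNeg c {{ℚ.nonNegative (ℚ.≤-trans 0≤a a≤c)}} d≤e)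

^ℚ-monoˡ-≤ : ∀ {x y} n → 0ℚ ℚ.≤ x → x ℚ.≤ y → x ^ℚ n ℚ.≤ y ^ℚ n
^ℚ-monoˡ-≤ zero    0≤x x≤y = ℚ.≤-refl
^ℚ-monoˡ-≤ (suc n) 0≤x x≤y = *ℚ-mono-≤ 0≤x (^ℚ-nonNegative n 0≤x) x≤y (^ℚ-monoˡ-≤ n 0≤x x≤y)

0≤½^ : ∀ n → 0ℚ ℚ.≤ ½ ^ℚ n
0≤½^ n = ^ℚ-nonNegative n (ℚ.nonNegative⁻¹ ½)

½^-antimono : ∀ {a c} → a ≤ c → ½ ^ℚ c ℚ.≤ ½ ^ℚ a
½^-antimono {a} {c} a≤c = begin
  ½ ^ℚ c                       ≡⟨ cong (½ ^ℚ_) (ℕ.m+[n∸m]≡n a≤c) ⟨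
  ½ ^ℚ (a ℕ.+ (c ℕ.∸ a))       ≡⟨ ^-homo-* ½ a (c ℕ.∸ a) ⟩
  ½ ^ℚ a ℚ.* ½ ^ℚ (c ℕ.∸ a)    ≤⟨ ℚ.*-monoˡ-≤-nonNeg (½ ^ℚ a) {{ℚ.nonNegative (0≤½^ a)}} (½^≤1 (c ℕ.∸ a)) ⟩
  ½ ^ℚ a ℚ.* 1ℚ                ≡⟨ ℚ.*-identityʳ (½ ^ℚ a) ⟩
  ½ ^ℚ a                       ∎
  where
  open ℚ.≤-Reasoning
  ½^≤1 : ∀ n → ½ ^ℚ n ℚ.≤ 1ℚ
  ½^≤1 zero    = ℚ.≤-refl
  ½^≤1 (suc n) = ℚ.≤-trans (*ℚ-mono-≤ {½} {1ℚ} (ℚ.nonNegative⁻¹ ½) (0≤½^ n) (*≤* (ℤ.+≤+ (s≤s z≤n))) (½^≤1 n))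
                           (ℚ.≤-reflexive (ℚ.*-identityˡ 1ℚ))

2^*½^≡1 : ∀ n → ℕ→ℚ (2 ℕ.^ n) ℚ.* ½ ^ℚ n ≡ 1ℚ
2^*½^≡1 n = begin
  ℕ→ℚ (2 ℕ.^ n) ℚ.* ½ ^ℚ n   ≡⟨ cong (ℚ._* ½ ^ℚ n) (ℕ→ℚ-^ 2 n) ⟩
  ℕ→ℚ 2 ^ℚ n ℚ.* ½ ^ℚ n      ≡⟨ ^-distrib-* (ℕ→ℚ 2) ½ n ⟨
  1ℚ ^ℚ n                     ≡⟨ 1^ n ⟩
  1ℚ                          ∎
  where
  open ≡-Reasoning
  1^ : ∀ n → 1ℚ ^ℚ n ≡ 1ℚ
  1^ zero    = refl
  1^ (suc n) = trans (ℚ.*-identityˡ _) (1^ n)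

-- Lower bounds for the logarithm and its powers.

1+u^≤1+2iu : ∀ {u} i → 0ℚ ℚ.≤ u → ℕ→ℚ 2 ℚ.* (ℕ→ℚ i ℚ.* u) ℚ.≤ 1ℚ →
             (1ℚ ℚ.+ u) ^ℚ i ℚ.≤ 1ℚ ℚ.+ ℕ→ℚ 2 ℚ.* (ℕ→ℚ i ℚ.* u)
1+u^≤1+2iu {u} zero    0≤u _     = ℚ.≤-reflexive (sym (solve 1 (λ u → con 1ℚ :+ con (ℕ→ℚ 2) :* (con 0ℚ :* u) := con 1ℚ) refl u))
  where open +-*-Solver
1+u^≤1+2iu {u} (suc i) 0≤u small = begin
  (1ℚ ℚ.+ u) ℚ.* (1ℚ ℚ.+ u) ^ℚ i
    ≤⟨ ℚ.*-monoˡ-≤-nonNeg (1ℚ ℚ.+ u) {{ℚ.nonNegative (ℚ.+-mono-≤ (ℚ.nonNegative⁻¹ 1ℚ) 0≤u)}}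
         (1+u^≤1+2iu i 0≤u small′) ⟩
  (1ℚ ℚ.+ u) ℚ.* (1ℚ ℚ.+ z)
    ≡⟨ solve 2 (λ u z → (con 1ℚ :+ u) :* (con 1ℚ :+ z) := con 1ℚ :+ z :+ u :+ z :* u) refl u z ⟩
  1ℚ ℚ.+ z ℚ.+ u ℚ.+ z ℚ.* u
    -- Since `z` is at most 1, the quadratic term costs at most another `u`, whence the 2 in this
    -- reverse Bernoulli inequality.
    ≤⟨ ℚ.+-monoʳ-≤ (1ℚ ℚ.+ z ℚ.+ u) (ℚ.*-monoʳ-≤-nonNeg u {{ℚ.nonNegative 0≤u}} small′) ⟩
  1ℚ ℚ.+ z ℚ.+ u ℚ.+ 1ℚ ℚ.* u
    ≡⟨ solve 2 (λ u i → con 1ℚ :+ con (ℕ→ℚ 2) :* (i :* u) :+ u :+ con 1ℚ :* u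
                     := con 1ℚ :+ con (ℕ→ℚ 2) :* ((con 1ℚ :+ i) :* u)) refl u (ℕ→ℚ i) ⟩
  1ℚ ℚ.+ ℕ→ℚ 2 ℚ.* ((1ℚ ℚ.+ ℕ→ℚ i) ℚ.* u)
    ≡⟨ cong (λ x → 1ℚ ℚ.+ ℕ→ℚ 2 ℚ.* (x ℚ.* u)) (ℕ→ℚ-suc i) ⟨
  1ℚ ℚ.+ ℕ→ℚ 2 ℚ.* (ℕ→ℚ (suc i) ℚ.* u) ∎
  where
  open ℚ.≤-Reasoning
  open +-*-Solver
  z = ℕ→ℚ 2 ℚ.* (ℕ→ℚ i ℚ.* u)

  small′ : z ℚ.≤ 1ℚ
  small′ = ℚ.≤-trans (ℚ.*-monoˡ-≤-nonNeg (ℕ→ℚ 2)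
    (ℚ.*-monoʳ-≤-nonNeg u {{ℚ.nonNegative 0≤u}} (ℕ→ℚ-mono-≤ (ℕ.n≤1+n i)))) small

ℕ→ℚ*1/ : ∀ j → ℕ→ℚ (suc j) ℚ.* (ℤ.+ 1 ℚ./ suc j) ≡ 1ℚ
ℕ→ℚ*1/ j = ℚ.toℚᵘ-injective (begin
  toℚᵘ (ℕ→ℚ (suc j) ℚ.* (ℤ.+ 1 ℚ./ suc j))  ≈⟨ ℚ.toℚᵘ-homo-* (ℕ→ℚ (suc j)) (ℤ.+ 1 ℚ./ suc j) ⟩
  toℚᵘ (ℕ→ℚ (suc j)) ℚᵘ.* toℚᵘ (ℤ.+ 1 ℚ./ suc j)
    ≈⟨ ℚᵘ.*-cong (ℚ.toℚᵘ-fromℚᵘ (ℚᵘ.mkℚᵘ (ℤ.+ suc j) 0)) (ℚ.toℚᵘ-fromℚᵘ (ℚᵘ.mkℚᵘ (ℤ.+ 1) j)) ⟩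
  ℚᵘ.mkℚᵘ (ℤ.+ suc j) 0 ℚᵘ.* ℚᵘ.mkℚᵘ (ℤ.+ 1) j  ≈⟨ ℚᵘ.*≡* (trans (ℤ.*-identityʳ _) (trans (ℤ.*-identityʳ _)
      (sym (trans (ℤ.*-identityˡ _) (cong (λ z → ℤ.+ suc z) (ℕ.+-identityʳ j)))))) ⟩
  toℚᵘ 1ℚ ∎)
  where
  open import Relation.Binary.Reasoning.Setoid ℚᵘ.≃-setoid

-- If `a` were below ½, every approximation of its exponential would be at most 1 + 2a, hence at
-- most 2, and could not exceed `n`.
½≤ln : ∀ {n} a → 2 ≤ n → lnᵘ n a → ½ ℚ.≤ a
½≤ln {n} a 2≤n (0<a , j , n<) = ℚ.≮⇒≥ λ a<½ → flip ≤⇒≯ n< (begin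
  (1ℚ ℚ.+ u) ^ℚ suc j                              ≤⟨ 1+u^≤1+2iu (suc j) 0≤u (2ja≤1 a<½) ⟩
  1ℚ ℚ.+ ℕ→ℚ 2 ℚ.* (ℕ→ℚ (suc j) ℚ.* u)           ≤⟨ ℚ.+-monoʳ-≤ 1ℚ (2ja≤1 a<½) ⟩
  1ℚ ℚ.+ 1ℚ                                        ≤⟨ ℕ→ℚ-mono-≤ 2≤n ⟩
  ℕ→ℚ n                                            ∎)
  where
  open ℚ.≤-Reasoning
  u = a ℚ.* (ℤ.+ 1 ℚ./ suc j)

  ju≡a : ℕ→ℚ (suc j) ℚ.* u ≡ a
  ju≡a = trans (solve 3 (λ J a i → J :* (a :* i) := a :* (J :* i)) refl (ℕ→ℚ (suc j)) a (ℤ.+ 1 ℚ./ suc j))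
               (trans (cong (a ℚ.*_) (ℕ→ℚ*1/ j)) (ℚ.*-identityʳ a))
    where open +-*-Solver

  0≤u : 0ℚ ℚ.≤ u
  0≤u = ℚ.*-cancelˡ-≤-pos (ℕ→ℚ (suc j)) {{ℚ.positive (0<ℕ→ℚsuc j)}}
    (subst₂ ℚ._≤_ (sym (ℚ.*-zeroʳ (ℕ→ℚ (suc j)))) (sym ju≡a) (ℚ.<⇒≤ 0<a))

  2ja≤1 : a ℚ.< ½ → ℕ→ℚ 2 ℚ.* (ℕ→ℚ (suc j) ℚ.* u) ℚ.≤ 1ℚ
  2ja≤1 a<½ = begin
    ℕ→ℚ 2 ℚ.* (ℕ→ℚ (suc j) ℚ.* u)  ≡⟨ cong (ℕ→ℚ 2 ℚ.*_) ju≡a ⟩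
    ℕ→ℚ 2 ℚ.* a                     ≤⟨ ℚ.*-monoˡ-≤-nonNeg (ℕ→ℚ 2) (ℚ.<⇒≤ a<½) ⟩
    ℕ→ℚ 2 ℚ.* ½                     ≡⟨⟩
    1ℚ                              ∎

lower<upper : ∀ (x : ℝ) {r s} → Lower x r → Upper x s → r ℚ.< s
lower<upper x {r} {s} l u with ℚ.<-cmp r s
... | tri< r<s _ _ = r<s
... | tri≈ _ refl _ = contradiction (l , u) (disjoint x r)
... | tri> _ _ s<r = contradiction (l , Equivalence.from (upper-rounded x r) (s , s<r , u)) (disjoint x r)

exponent-bound : ∀ r e → r ℚ.≤ ℕ→ℚ e → 0ℚ ℚ.≤ r → ℤ.∣ ↥ r ∣ ≤ e ℕ.* ↧ₙ r
exponent-bound r@(ℚ.mkℚ (ℤ.+ p) d _) e r≤e _ = ℤ.drop‿+≤+ (begin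
  ℤ.+ p                  ≡⟨ ℤ.*-identityʳ (ℤ.+ p) ⟨
  ℤ.+ p ℤ.* ℤ.+ 1        ≤⟨ ℚ.drop-*≤* (subst (r ℚ.≤_) (ℕ→ℚ≡fromℤ e) r≤e) ⟩
  ℤ.+ e ℤ.* ℤ.+ suc d    ≡⟨ ℤ.pos-* e (suc d) ⟨
  ℤ.+ (e ℕ.* suc d)      ∎)
  where open ℤ.≤-Reasoning
exponent-bound (ℚ.mkℚ (ℤ.-[1+ p ]) d _) e _ (*≤* ())

-- With base at least ½ and exponent `r` at most `e`, the power is at least `½ ^ℚ e`. The
-- logarithmic factor is therefore bounded below by a constant.
½^<power : ∀ {n} (y : ℝ) {s} e → 2 ≤ n → Upper y s → s ℚ.≤ ℕ→ℚ e → ∀ {q} → (lnᵘ n ^ʳ y) q → ½ ^ℚ e ℚ.< q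
½^<power {n} y {s} e 2≤n ys s≤e {q} (a , r , _ , ln<a , 0≤r , yr , _ , (0<q , a^r<q) , _) = ℚ.≰⇒> λ q≤ →
  flip ≤⇒≯ a^r<q (begin
    -- Both sides are raised to the denominator `d` of `r`, the form in which `Power<` states its
    -- inequality.
    q ^ℚ d                ≤⟨ ^ℚ-monoˡ-≤ d (ℚ.<⇒≤ 0<q) q≤ ⟩
    (½ ^ℚ e) ^ℚ d         ≡⟨ ^-assocʳ ½ e d ⟩
    ½ ^ℚ (e ℕ.* d)        ≤⟨ ½^-antimono (exponent-bound r e (ℚ.≤-trans (ℚ.<⇒≤ (lower<upper y yr ys)) s≤e) 0≤r) ⟩
    ½ ^ℚ p                ≤⟨ ^ℚ-monoˡ-≤ p (ℚ.nonNegative⁻¹ ½) (½≤ln a 2≤n ln<a) ⟩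
    a ^ℚ p                ∎)
  where
  open ℚ.≤-Reasoning
  p = ℤ.∣ ↥ r ∣
  d = ↧ₙ r

theorem2p4 : (k : ℕ) → 2 ≤ k → (π : Permutation′ k) →
    (ε δ₀ Δ₀ : ℝ) → fromℕ 0 <ℝ ε → fromℕ 1 ≤ℝ δ₀ → fromℕ 0 <ℝ Δ₀ →
    ∃[ c ] (fromℕ 0 <ℝ c ×
    ((n L : ℕ) → 2 ≤ n → .{{_ : NonZero L}} →
    (Λ : UniformHypergraph k n) (𝒞 : List (Subset n)) →
    Unique 𝒞 → All (IsClique Λ L) 𝒞 →
    ((v : Fin n) → (δ₀ ≤ℝ fromℕ (degree 𝒞 v)) × (fromℕ (degree 𝒞 v) ≤ℝ Δ₀)) →
    Upper (fromℕ (avoidingCount Λ π)) ≤ᵘ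
    ((Upper c *ᵘ Upper (fromℕ n) *ᵘ (lnᵘ n ^ʳ (ℕ→ℚ 2 +ℝ ε))) /ᵘ L) ^ᵘ n))
theorem2p4 k 2≤k π ε δ₀ Δ₀ _ 1≤δ₀ _ = fromℕ C , ℚ.<-dense (0<ℕ→ℚsuc (Δ ℕ.* growth k ℕ.* 2 ℕ.^ e)) , bound
  where
  y = ℕ→ℚ 2 +ℝ ε
  s = proj₁ (upper-inhabited y)
  e = ceil s
  Δ = ceil (proj₁ (upper-inhabited Δ₀))
  -- `Δ` bounds the degrees, `growth k` comes from Stanley-Wilf, and `2 ℕ.^ e` compensates the lower
  -- bound `½ ^ℚ e` of the logarithmic factor. The successor makes the constant positive.
  C = suc (Δ ℕ.* growth k ℕ.* 2 ℕ.^ e)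

  bound : (n L : ℕ) → 2 ≤ n → .{{_ : NonZero L}} →
    (Λ : UniformHypergraph k n) (𝒞 : List (Subset n)) → Unique 𝒞 → All (IsClique Λ L) 𝒞 →
    ((v : Fin n) → (δ₀ ≤ℝ fromℕ (degree 𝒞 v)) × (fromℕ (degree 𝒞 v) ≤ℝ Δ₀)) →
    Upper (fromℕ (avoidingCount Λ π)) ≤ᵘ
    ((Upper (fromℕ C) *ᵘ Upper (fromℕ n) *ᵘ (lnᵘ n ^ʳ y)) /ᵘ L) ^ᵘ n
  bound n L 2≤n Λ 𝒞 _ cliques degrees {q}
    -- Unfolding the cuts, `a` lies above the base of the bound, `b₁` above the constant times `n`,
    -- and `b₂` above the logarithmic power. It suffices that the count is at most `a ^ℚ n`.
    (a , (b₁ , b₂ , (c′ , n′ , C<c′ , n<n′ , c′n′<b₁) , power , b₁b₂<aL) , a^n<q) =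
    ℚ.≤-<-trans count≤a^n a^n<q
    where
    open ℚ.≤-Reasoning
    instance
      k≢0 : NonZero k
      k≢0 = ℕ.>-nonZero (ℕ.≤-trans (s≤s z≤n) 2≤k)
      n≢0 : NonZero n
      n≢0 = ℕ.>-nonZero (ℕ.≤-trans (s≤s z≤n) 2≤n)

    degree>0 : ∀ v → 0 ℕ.< degree 𝒞 v
    -- Degree 0 would put 1 into the upper cut of `δ₀`, and then 1 would be less than itself.
    degree>0 v = ℕ.≰⇒> λ d≤0 → ℚ.<-irrefl refl
      (1≤δ₀ (proj₁ (degrees v) (ℕ→ℚ-mono-< (s≤s d≤0))))

    degree≤Δ : ∀ v → degree 𝒞 v ≤ Δ
    degree≤Δ v = ℕ.<⇒≤ (ℕ→ℚ-cancel-< (ℚ.<-≤-trans (proj₂ (degrees v) (proj₂ (upper-inhabited Δ₀))) (q≤ceil _)))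

    avoiding = avoidingCount Λ π
    base = n ℕ.* Δ ℕ.* growth k

    base≤aL : ℕ→ℚ base ℚ.≤ a ℚ.* ℕ→ℚ L
    base≤aL = begin
      ℕ→ℚ base
        ≡⟨ trans (cong₂ ℚ._*_ (2^*½^≡1 e) refl) (ℚ.*-identityˡ (ℕ→ℚ base)) ⟨
      ℕ→ℚ (2 ℕ.^ e) ℚ.* ½ ^ℚ e ℚ.* ℕ→ℚ base
        ≡⟨ solve 3 (λ x h z → x :* h :* z := z :* x :* h) refl (ℕ→ℚ (2 ℕ.^ e)) (½ ^ℚ e) (ℕ→ℚ base) ⟩
      ℕ→ℚ base ℚ.* ℕ→ℚ (2 ℕ.^ e) ℚ.* ½ ^ℚ e
        ≡⟨ cong (ℚ._* ½ ^ℚ e) (ℕ→ℚ-* base (2 ℕ.^ e)) ⟨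
      ℕ→ℚ (base ℕ.* 2 ℕ.^ e) ℚ.* ½ ^ℚ e
        ≤⟨ *ℚ-mono-≤ {ℕ→ℚ (base ℕ.* 2 ℕ.^ e)} {b₁} (0≤ℕ→ℚ (base ℕ.* 2 ℕ.^ e)) (0≤½^ e) base2^≤b₁
             (ℚ.<⇒≤ (½^<power y e 2≤n (proj₂ (upper-inhabited y)) (q≤ceil s) power)) ⟩
      b₁ ℚ.* b₂     <⟨ b₁b₂<aL ⟩
      a ℚ.* ℕ→ℚ L   ∎
      where
      open +-*-Solver
      rearrange : ∀ n Δ g x → n ℕ.* Δ ℕ.* g ℕ.* x ≡ Δ ℕ.* g ℕ.* x ℕ.* n
      rearrange = solve-∀

      base2^≤b₁ : ℕ→ℚ (base ℕ.* 2 ℕ.^ e) ℚ.≤ b₁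
      base2^≤b₁ = begin
        ℕ→ℚ (base ℕ.* 2 ℕ.^ e)   ≡⟨ cong ℕ→ℚ (rearrange n Δ (growth k) (2 ℕ.^ e)) ⟩
        ℕ→ℚ (Δ ℕ.* growth k ℕ.* 2 ℕ.^ e ℕ.* n)  ≤⟨ ℕ→ℚ-mono-≤ (ℕ.*-monoˡ-≤ n (ℕ.n≤1+n (Δ ℕ.* growth k ℕ.* 2 ℕ.^ e))) ⟩
        ℕ→ℚ (C ℕ.* n)            ≡⟨ ℕ→ℚ-* C n ⟩
        ℕ→ℚ C ℚ.* ℕ→ℚ n          ≤⟨ *ℚ-mono-≤ (0≤ℕ→ℚ C) (0≤ℕ→ℚ n) (ℚ.<⇒≤ C<c′) (ℚ.<⇒≤ n<n′) ⟩
        c′ ℚ.* n′                <⟨ c′n′<b₁ ⟩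
        b₁                       ∎

    count≤a^n : ℕ→ℚ avoiding ℚ.≤ a ^ℚ n
    count≤a^n = ℚ.*-cancelʳ-≤-pos (ℕ→ℚ (L ℕ.^ n)) {{ℚ.positive (ℕ→ℚ-mono-< {0} (ℕ.m^n>0 L n))}} (begin
      ℕ→ℚ avoiding ℚ.* ℕ→ℚ (L ℕ.^ n)  ≡⟨ ℕ→ℚ-* avoiding (L ℕ.^ n) ⟨
      ℕ→ℚ (avoiding ℕ.* L ℕ.^ n)      ≤⟨ ℕ→ℚ-mono-≤ (avoidingCount-bound Λ 𝒞 cliques degree>0 degree≤Δ π) ⟩
      ℕ→ℚ (base ℕ.^ n)                ≡⟨ ℕ→ℚ-^ base n ⟩
      ℕ→ℚ base ^ℚ n                   ≤⟨ ^ℚ-monoˡ-≤ n (0≤ℕ→ℚ base) base≤aL ⟩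
      (a ℚ.* ℕ→ℚ L) ^ℚ n              ≡⟨ ^-distrib-* a (ℕ→ℚ L) n ⟩
      a ^ℚ n ℚ.* ℕ→ℚ L ^ℚ n           ≡⟨ cong (a ^ℚ n ℚ.*_) (ℕ→ℚ-^ L n) ⟨
      a ^ℚ n ℚ.* ℕ→ℚ (L ℕ.^ n)        ∎)
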